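{- Let $k\ge 1$, $b>0$, $c>0$ be integers such that $b+c=q^s$ for some integer $s>0$ and prime $q$. Then there exist nonnegative integers $l_1,\dots,l_k$ such that the infinite circulant graph $C_\infty(l_1,\dots,l_k)$ with $k$ distances has a perfect $2$-colouring with parameters $(b,c)$ if and only if $$b+c\le 2k+\gcd(b,c).$$
   Context: Graphs may have loops and multiple edges. The infinite circulant graph with $k$ distances $C_\infty(l_1,\dots,l_k)$ has vertex set $\mathbb{Z}$, and numbers differing by $l_i$, for some $i$, are joined by an edge; it is $2k$-regular, the neighbours of a vertex $g$, counted with multiplicity, being $g+l_i$ and $g-l_i$ for $i=1,\dots,k$. (The $l_i$ are not required to be distinct or nonzero.) A perfect $2$-colouring with parameters $(b,c)$ of a regular graph is a colouring of its vertices in two colours (black and white) such that each black vertex has exactly $b$ white neighbours and each white vertex has exactly $c$ black neighbours (neighbours counted with multiplicity). -}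

module Defs where

open import Axiom.UniquenessOfIdentityProofs using (module Decidable⇒UIP)
open import Data.Integer using (ℤ; +_; _+_; _-_)
open import Data.Integer.Properties using (_≟_; +-0-abelianGroup)
open import Data.Nat using (ℕ; _*_)
open import Data.Vec using (Vec; []; _∷_; map; concat; count)
open import Data.Vec.Membership.Propositional using (_∈_)
open import Data.Vec.Relation.Unary.Any using (here; there)
open import Function.Bundles using (_↔_; mk↔ₛ′)
open import Relation.Binary.Definitions using (DecidableEquality)
open import Relation.Binary.PropositionalEquality
  using (_≡_; refl; sym; cong)
open import Relation.Nullary using (yes; no)

import Algebra.Properties.AbelianGroup +-0-abelianGroup as ℤ-Group
open Decidable⇒UIP _≟_ using (≡-irrelevant)

-- A d-regular graph, loops and multiple edges allowed.  A neighbour is listed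
-- once for each of its multiplicities, so the bijection in `symmetric` says that
-- u occurs among the neighbours of v as often as v among those of u.
record RegularGraph (d : ℕ) : Set₁ where
  field
    Vertex     : Set
    neighbours : Vertex → Vec Vertex d
    symmetric  : ∀ u v → u ∈ neighbours v ↔ v ∈ neighbours u

data Colour : Set where
  black white : Colour

_≟ᶜ_ : DecidableEquality Colour
black ≟ᶜ black = yes refl
black ≟ᶜ white = no λ ()
white ≟ᶜ black = no λ ()
white ≟ᶜ white = yes refl

module _ {d : ℕ} (G : RegularGraph d) where
  open RegularGraph G

  Colouring : Set
  Colouring = Vertex → Colour

  #neighbours : Colouring → Colour → Vertex → ℕ
  #neighbours f x v = count (λ u → f u ≟ᶜ x) (neighbours v)

  record IsPerfectColouring (b c : ℕ) (f : Colouring) : Set where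
    field
      black-vertex : ∀ v → f v ≡ black → #neighbours f white v ≡ b
      white-vertex : ∀ v → f v ≡ white → #neighbours f black v ≡ c

circulantNeighbours : ∀ {k} → Vec ℕ k → ℤ → Vec ℤ (k * 2)
circulantNeighbours ls g = concat (map (λ l → (g + + l) ∷ (g - + l) ∷ []) ls)

private
  +⇒- : ∀ {u v} l → u ≡ v + l → v ≡ u - l
  +⇒- {v = v} l refl = sym (ℤ-Group.//-rightDividesʳ l v)

  -⇒+ : ∀ {u v} l → u ≡ v - l → v ≡ u + l
  -⇒+ {v = v} l refl = sym (ℤ-Group.//-rightDividesˡ l v)

  swap : ∀ {k} (ls : Vec ℕ k) u v →
         u ∈ circulantNeighbours ls v → v ∈ circulantNeighbours ls u
  swap (l ∷ ls) u v (here p)          = there (here (+⇒- (+ l) p))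
  swap (l ∷ ls) u v (there (here p))  = here (-⇒+ (+ l) p)
  swap (l ∷ ls) u v (there (there p)) = there (there (swap ls u v p))

  swap-swap : ∀ {k} (ls : Vec ℕ k) u v (p : u ∈ circulantNeighbours ls v) →
              swap ls v u (swap ls u v p) ≡ p
  swap-swap (l ∷ ls) u v (here p)          = cong here (≡-irrelevant _ p)
  swap-swap (l ∷ ls) u v (there (here p))  = cong (λ e → there (here e)) (≡-irrelevant _ p)
  swap-swap (l ∷ ls) u v (there (there p)) = cong (λ e → there (there e)) (swap-swap ls u v p)

C∞ : ∀ {k} → Vec ℕ k → RegularGraph (k * 2)
C∞ ls = record
  { Vertex     = ℤ
  ; neighbours = circulantNeighbours ls
  ; symmetric  = λ u v → mk↔ₛ′ (swap ls u v) (swap ls v u) (swap-swap ls v u) (swap-swap ls u v)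
  }

{-# OPTIONS --safe #-}

-- Necessity. A perfect colouring is eventually periodic, so its indicator g solves
-- A g = c, where A is the adjacency operator minus 2k - n and n = b + c = q ^ s.  For
-- each j the value of A at a primitive q ^ j-th root of unity ζ, or that of g, is zero,
-- because ℤ[ζ] is a domain.  Let t be the number of levels j at which A vanishes.
-- There the vanishing of A divides by q the number of displacements that are multiples
-- of q ^ j, shifted by n - 2k; this number starts at n and never falls below n - 2k, so
-- (n - 2k) q ^ t ≤ n.  The vanishing of g at the other levels makes its sum over a
-- period divisible by the corresponding power of q, and since n times this sum is c
-- times the period, n divides q ^ t c.  Hence n ≤ q ^ t gcd(b, c), and the bound follows.
--
-- Sufficiency. Let d = gcd(b, c) and m = n / d.  Colour x by its residue modulo m, with
-- c / d black residues, and take distances whose neighbours cover every nonzero residue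
-- d times, padding with zeros.  Each residue comes with its negative, so this fails
-- exactly when d is odd and m is even; then d = 1 and the distances 1, 3, …, n - 1 serve.
module Submission where

open import Defs
open import Data.Integer using (ℤ)
import Data.Nat as ℕ
open ℕ using (ℕ; zero; suc)
import Data.Nat.Divisibility as ℕ∣
import Data.Nat.DivMod as ℕ/
open import Data.Nat.Induction using (<-rec)
open import Data.Nat.Primality
  using (Prime; euclidsLemma; prime[2]; prime⇒irreducible; prime⇒nonTrivial; prime⇒nonZero)
import Data.Nat.Properties as ℕₚ
open import Data.Product using (∃-syntax; Σ-syntax; _×_; _,_; proj₁; proj₂)
open import Data.Sum using (_⊎_; inj₁; inj₂; [_,_]′)
import Data.Sum as Sum
open import Data.Vec using (Vec; []; _∷_)
open import Function using (_∘_)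
open import Relation.Binary.PropositionalEquality
open import Relation.Nullary using (yes; no; contradiction; ¬_; Dec; does)

-- No ring of algebraic integers is constructed. A sequence of period `q ^ (1 + j)` vanishes at the
-- primitive `q ^ (1 + j)`-th roots of unity exactly when it already has period `q ^ j`, so each
-- vanishing statement is expressed as a shorter period of an integer sequence. Sequences live on ℕ:
-- the recurrence is only run forwards, and once a period is known, negative displacements are
-- avoided by adding multiples of it. The period found has the form `r * q ^ a` with `r` prime to
-- `q`; averaging over `r` translates discards the roots of unity whose order is not a power of `q`,
-- at the cost of a factor `r` that divisibility by a power of `q` does not see.
--
-- In the construction the obstacle is the residue `m / 2`, which is its own negative: both
-- neighbours at such a distance land on it, so it is covered an even number of times. In the
-- exceptional case the residue colouring is therefore pulled back along the floor of `x / 2`. The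
-- `n` neighbours at odd distances have one parity and meet each of `n` consecutive pairs `2i`,
-- `2i + 1` once.

-- Binomial coefficients divisible by a prime.

module Binomial where
  open import Data.Nat using (_+_; _*_; _^_; _<_; z<s; s<s)
  open import Data.Nat.Divisibility using (_∣_; _∤_; divides; ∣⇒≤; *-cancelˡ-∣; ∣-trans; m∣m*n; _∣?_; 1∣_; *-monoʳ-∣)
  open import Data.Nat.Properties
  open import Data.Nat.Combinatorics using (_C_; nCk+nC[k+1]≡[n+1]C[k+1]; k>n⇒nCk≡0)
  open import Data.Nat.Tactic.RingSolver using (solve-∀)

  -- The absorption identity, obtained from Pascal's rule so that neither factorials nor division
  -- occur.
  [1+k]*[1+n]C[1+k]≡[1+n]*nCk : ∀ n k → suc k * (suc n C suc k) ≡ suc n * (n C k)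
  [1+k]*[1+n]C[1+k]≡[1+n]*nCk zero zero = refl
  [1+k]*[1+n]C[1+k]≡[1+n]*nCk zero (suc k)
    rewrite k>n⇒nCk≡0 {1} {suc (suc k)} (s<s z<s) | k>n⇒nCk≡0 {0} {suc k} z<s = *-zeroʳ k
  [1+k]*[1+n]C[1+k]≡[1+n]*nCk (suc n) zero = begin
    1 * (suc (suc n) C 1)         ≡⟨ cong (1 *_) (nCk+nC[k+1]≡[n+1]C[k+1] (suc n) 0) ⟨
    1 * (1 + (suc n C 1))         ≡⟨ *-identityˡ _ ⟩
    1 + (suc n C 1)               ≡⟨ cong (1 +_) (*-identityˡ (suc n C 1)) ⟨
    1 + 1 * (suc n C 1)           ≡⟨ cong (1 +_) ([1+k]*[1+n]C[1+k]≡[1+n]*nCk n 0) ⟩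
    1 + suc n * 1                 ≡⟨⟩
    suc (suc n) * 1               ∎
    where open ≡-Reasoning
  [1+k]*[1+n]C[1+k]≡[1+n]*nCk (suc n) (suc k) = begin
    suc (suc k) * (suc (suc n) C suc (suc k))
      ≡⟨ cong (suc (suc k) *_) (nCk+nC[k+1]≡[n+1]C[k+1] (suc n) (suc k)) ⟨
    suc (suc k) * (x + (suc n C suc (suc k)))
      ≡⟨ *-distribˡ-+ (suc (suc k)) x _ ⟩
    x + suc k * x + suc (suc k) * (suc n C suc (suc k))
      ≡⟨ cong₂ (λ a b → x + a + b) ([1+k]*[1+n]C[1+k]≡[1+n]*nCk n k) ([1+k]*[1+n]C[1+k]≡[1+n]*nCk n (suc k)) ⟩
    x + suc n * (n C k) + suc n * (n C suc k)
      ≡⟨ +-assoc x _ _ ⟩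
    x + (suc n * (n C k) + suc n * (n C suc k))
      ≡⟨ cong (x +_) (*-distribˡ-+ (suc n) (n C k) _) ⟨
    x + suc n * ((n C k) + (n C suc k))
      ≡⟨ cong (λ a → x + suc n * a) (nCk+nC[k+1]≡[n+1]C[k+1] n k) ⟩
    suc (suc n) * x ∎
    where
    open ≡-Reasoning
    x = suc n C suc k

  module _ {q : ℕ} (q-prime : Prime q) where
    private instance _ = prime⇒nonZero q-prime

    q^j∣m*n⇒q^j∣n : ∀ j {m n} → q ∤ m → q ^ j ∣ m * n → q ^ j ∣ n
    q^j∣m*n⇒q^j∣n zero    q∤m _ = 1∣ _
    q^j∣m*n⇒q^j∣n (suc j) {m} {n} q∤m q^1+j∣m*n
      with euclidsLemma m n q-prime (∣-trans (m∣m*n (q ^ j)) q^1+j∣m*n)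
    ... | inj₁ q∣m = contradiction q∣m q∤m
    ... | inj₂ (divides n′ refl) = subst (q ^ suc j ∣_) (*-comm q n′)
          (*-monoʳ-∣ q (q^j∣m*n⇒q^j∣n j q∤m (*-cancelˡ-∣ q (subst (q * q ^ j ∣_) (rearrange m n′ q) q^1+j∣m*n))))
      where
      rearrange : ∀ a b c → a * (b * c) ≡ c * (a * b)
      rearrange = solve-∀

    -- By absorption `q ^ j` divides the coefficient times `k`. If `q` did not divide the
    -- coefficient, all of `q ^ j` would divide `k`, which is too small.
    q∣q^jCk : ∀ j {k} → 0 < k → k < q ^ j → q ∣ (q ^ j) C k
    q∣q^jCk j {suc k} _ k<q^j with q ∣? ((q ^ j) C suc k)
    ... | yes q∣C = q∣C
    ... | no  q∤C = contradiction (∣⇒≤ (q^j∣m*n⇒q^j∣n j q∤C q^j∣C*k)) (<⇒≱ k<q^j)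
      where
      q^j∣C*k : q ^ j ∣ ((q ^ j) C suc k) * suc k
      q^j∣C*k with q ^ j | m^n≢0 q j
      ... | suc n | _ = divides (n C k) (begin
        (suc n C suc k) * suc k ≡⟨ *-comm (suc n C suc k) (suc k) ⟩
        suc k * (suc n C suc k) ≡⟨ [1+k]*[1+n]C[1+k]≡[1+n]*nCk n k ⟩
        suc n * (n C k)         ≡⟨ *-comm (suc n) (n C k) ⟩
        (n C k) * suc n         ∎)
        where open ≡-Reasoning

-- Integer sequences: finite sums, periods and iterated differences.

module Sequences where
  open import Data.Integer
    using (ℤ; +_; 0ℤ; _+_; _*_; -_; _-_)
  open import Data.Integer.Properties as ℤₚ using ()
  open import Data.Integer.Divisibility.Signed
  open import Data.Nat.Combinatorics using (_C_; nCk+nC[k+1]≡[n+1]C[k+1]; k>n⇒nCk≡0; nCn≡1)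
  open import Data.Integer.Tactic.RingSolver using (solve-∀)

  Sequence : Set
  Sequence = ℕ → ℤ

  ∑ : ℕ → Sequence → ℤ
  ∑ zero    u = 0ℤ
  ∑ (suc n) u = ∑ n u + u n

  ∑-cong-< : ∀ n {u v : Sequence} → (∀ {x} → x ℕ.< n → u x ≡ v x) → ∑ n u ≡ ∑ n v
  ∑-cong-< zero    u≗v = refl
  ∑-cong-< (suc n) u≗v = cong₂ _+_ (∑-cong-< n (u≗v ∘ ℕₚ.m<n⇒m<1+n)) (u≗v (ℕₚ.n<1+n n))

  ∑-cong : ∀ n {u v : Sequence} → u ≗ v → ∑ n u ≡ ∑ n v
  ∑-cong n u≗v = ∑-cong-< n (λ {x} _ → u≗v x)

  private
    +-interchange : ∀ a b c d → (a + b) + (c + d) ≡ (a + c) + (b + d)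
    +-interchange = solve-∀

  ∑-distrib-+ : ∀ n (u v : Sequence) → ∑ n (λ x → u x + v x) ≡ ∑ n u + ∑ n v
  ∑-distrib-+ zero    u v = refl
  ∑-distrib-+ (suc n) u v = trans (cong (_+ (u n + v n)) (∑-distrib-+ n u v))
                                  (+-interchange (∑ n u) (∑ n v) (u n) (v n))

  *-distribˡ-∑ : ∀ n a (u : Sequence) → ∑ n (λ x → a * u x) ≡ a * ∑ n u
  *-distribˡ-∑ zero    a u = sym (ℤₚ.*-zeroʳ a)
  *-distribˡ-∑ (suc n) a u = trans (cong (_+ a * u n) (*-distribˡ-∑ n a u))
                                   (sym (ℤₚ.*-distribˡ-+ a (∑ n u) (u n)))

  ∑-const : ∀ n a → ∑ n (λ _ → a) ≡ + n * a
  ∑-const zero    a = sym (ℤₚ.*-zeroˡ a)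
  ∑-const (suc n) a = begin
    ∑ n (λ _ → a) + a ≡⟨ cong (_+ a) (∑-const n a) ⟩
    + n * a + a       ≡⟨ ℤₚ.+-comm (+ n * a) a ⟩
    a + + n * a       ≡⟨ ℤₚ.suc-* (+ n) a ⟨
    + suc n * a       ∎
    where open ≡-Reasoning

  ∑-suc : ∀ n (u : Sequence) → ∑ (suc n) u ≡ u 0 + ∑ n (u ∘ suc)
  ∑-suc zero    u = ℤₚ.+-comm 0ℤ (u 0)
  ∑-suc (suc n) u = trans (cong (_+ u (suc n)) (∑-suc n u)) (ℤₚ.+-assoc (u 0) _ _)

  ∑-+ : ∀ m n (u : Sequence) → ∑ (m ℕ.+ n) u ≡ ∑ m u + ∑ n (λ x → u (m ℕ.+ x))
  ∑-+ m zero    u rewrite ℕₚ.+-identityʳ m = sym (ℤₚ.+-identityʳ (∑ m u))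
  ∑-+ m (suc n) u rewrite ℕₚ.+-suc m n =
    trans (cong (_+ u (m ℕ.+ n)) (∑-+ m n u)) (ℤₚ.+-assoc (∑ m u) _ _)

  ∑-comm : ∀ m n (u : ℕ → Sequence) → ∑ m (λ x → ∑ n (u x)) ≡ ∑ n (λ y → ∑ m (λ x → u x y))
  ∑-comm zero    n u = sym (trans (∑-const n 0ℤ) (ℤₚ.*-zeroʳ (+ n)))
  ∑-comm (suc m) n u = trans (cong (_+ ∑ n (u m)) (∑-comm m n u))
                             (sym (∑-distrib-+ n (λ y → ∑ m (λ x → u x y)) (u m)))

  ∣-∑ : ∀ n {a} {u : Sequence} → (∀ {x} → x ℕ.< n → a ∣ u x) → a ∣ ∑ n u
  ∣-∑ zero    {a} a∣u = divides 0ℤ (sym (ℤₚ.*-zeroˡ a))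
  ∣-∑ (suc n) a∣u = ∣m∣n⇒∣m+n (∣-∑ n (a∣u ∘ ℕₚ.m<n⇒m<1+n)) (a∣u (ℕₚ.n<1+n n))

  Periodic : ℕ → Sequence → Set
  Periodic n u = ∀ x → u (x ℕ.+ n) ≡ u x

  periodic-* : ∀ {n u} m → Periodic n u → Periodic (m ℕ.* n) u
  periodic-* {u = u} zero per x = cong u (ℕₚ.+-identityʳ x)
  periodic-* {n} {u} (suc m) per x = begin
    u (x ℕ.+ (n ℕ.+ m ℕ.* n)) ≡⟨ cong u (ℕₚ.+-assoc x n (m ℕ.* n)) ⟨
    u (x ℕ.+ n ℕ.+ m ℕ.* n)   ≡⟨ periodic-* m per (x ℕ.+ n) ⟩
    u (x ℕ.+ n)               ≡⟨ per x ⟩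
    u x                       ∎
    where open ≡-Reasoning

  ∑-shift : ∀ {n u} → Periodic n u → ∀ d → ∑ n (λ x → u (x ℕ.+ d)) ≡ ∑ n u
  ∑-shift {n} {u} per zero    = ∑-cong n (λ x → cong u (ℕₚ.+-identityʳ x))
  ∑-shift {n} {u} per (suc d) = begin
    ∑ n (λ x → u (x ℕ.+ suc d))  ≡⟨ ∑-cong n (λ x → cong u (ℕₚ.+-suc x d)) ⟩
    ∑ n (v ∘ suc)                ≡⟨ cancel (v 0) _ ⟨
    v 0 + ∑ n (v ∘ suc) - v 0    ≡⟨ cong (_- v 0) (∑-suc n v) ⟨
    ∑ n v + v n - v 0            ≡⟨ cong (λ a → ∑ n v + a - v 0) (trans (cong u (ℕₚ.+-comm n d)) (per d)) ⟩
    ∑ n v + v 0 - v 0            ≡⟨ cancel′ (v 0) _ ⟩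
    ∑ n v                        ≡⟨ ∑-shift per d ⟩
    ∑ n u                        ∎
    where
    open ≡-Reasoning
    v : Sequence
    v x = u (x ℕ.+ d)
    cancel : ∀ a b → a + b - a ≡ b
    cancel = solve-∀
    cancel′ : ∀ a b → b + a - a ≡ b
    cancel′ = solve-∀

  ∑-periodic : ∀ m {n u} → Periodic n u → ∑ (m ℕ.* n) u ≡ + m * ∑ n u
  ∑-periodic zero    {n} {u} per = sym (ℤₚ.*-zeroˡ (∑ n u))
  ∑-periodic (suc m) {n} {u} per = begin
    ∑ (n ℕ.+ m ℕ.* n) u                          ≡⟨ ∑-+ n (m ℕ.* n) u ⟩
    ∑ n u + ∑ (m ℕ.* n) (λ x → u (n ℕ.+ x))      ≡⟨ cong (λ a → ∑ n u + a) (∑-cong (m ℕ.* n) (λ x → trans (cong u (ℕₚ.+-comm n x)) (per x))) ⟩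
    ∑ n u + ∑ (m ℕ.* n) u                        ≡⟨ cong (λ a → ∑ n u + a) (∑-periodic m per) ⟩
    ∑ n u + + m * ∑ n u                          ≡⟨ ℤₚ.suc-* (+ m) (∑ n u) ⟨
    + suc m * ∑ n u                              ∎
    where open ≡-Reasoning

  Δ : Sequence → Sequence
  Δ u x = u (suc x) - u x

  Δ^ : ℕ → Sequence → Sequence
  Δ^ zero    u = u
  Δ^ (suc n) u = Δ (Δ^ n u)

  Δ^-cong : ∀ n {u v} → u ≗ v → Δ^ n u ≗ Δ^ n v
  Δ^-cong zero    u≗v x = u≗v x
  Δ^-cong (suc n) u≗v x = cong₂ _-_ (Δ^-cong n u≗v (suc x)) (Δ^-cong n u≗v x)

  Δ^-* : ∀ n a u x → Δ^ n (λ y → a * u y) x ≡ a * Δ^ n u x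
  Δ^-* zero    a u x = refl
  Δ^-* (suc n) a u x = trans (cong₂ _-_ (Δ^-* n a u (suc x)) (Δ^-* n a u x)) (factor a _ _)
    where
    factor : ∀ a b c → a * b - a * c ≡ a * (b - c)
    factor = solve-∀

  Δ^-+ : ∀ m n u → Δ^ (m ℕ.+ n) u ≗ Δ^ m (Δ^ n u)
  Δ^-+ zero    n u x = refl
  Δ^-+ (suc m) n u x = cong₂ _-_ (Δ^-+ m n u (suc x)) (Δ^-+ m n u x)

  periodic-Δ^ : ∀ {m u} n → Periodic m u → Periodic m (Δ^ n u)
  periodic-Δ^ zero    per x = per x
  periodic-Δ^ (suc n) per x = cong₂ _-_ (periodic-Δ^ n per (suc x)) (periodic-Δ^ n per x)

  -- The shift by one is the identity plus `Δ`, so this is the binomial theorem for its `n`-th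
  -- power.
  newton : ∀ n u x → u (x ℕ.+ n) ≡ ∑ (suc n) (λ i → + (n C i) * Δ^ i u x)
  newton zero    u x = begin
    u (x ℕ.+ 0)          ≡⟨ cong u (ℕₚ.+-identityʳ x) ⟩
    u x                  ≡⟨ ℤₚ.*-identityˡ (u x) ⟨
    + 1 * u x            ≡⟨ ℤₚ.+-identityˡ _ ⟨
    0ℤ + + 1 * u x       ∎
    where open ≡-Reasoning
  newton (suc n) u x = begin
    u (x ℕ.+ suc n)                                   ≡⟨ cong u (ℕₚ.+-suc x n) ⟩
    u (suc x ℕ.+ n)                                   ≡⟨ newton n u (suc x) ⟩
    ∑ (suc n) (λ i → + (n C i) * Δ^ i u (suc x))      ≡⟨ ∑-cong (suc n) (λ i → split (+ (n C i)) (Δ^ i u (suc x)) (Δ^ i u x)) ⟩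
    ∑ (suc n) (λ i → A i + B i)                       ≡⟨ ∑-distrib-+ (suc n) A B ⟩
    ∑ (suc n) A + ∑ (suc n) B                         ≡⟨ cong (_+ ∑ (suc n) B) (ℤₚ.+-identityʳ (∑ (suc n) A)) ⟨
    ∑ (suc n) A + 0ℤ + ∑ (suc n) B                    ≡⟨ cong (λ a → ∑ (suc n) A + a + ∑ (suc n) B) top ⟨
    ∑ (suc (suc n)) A + ∑ (suc n) B                   ≡⟨ cong (_+ ∑ (suc n) B) (∑-suc (suc n) A) ⟩
    A 0 + ∑ (suc n) (A ∘ suc) + ∑ (suc n) B           ≡⟨ ℤₚ.+-assoc (A 0) _ _ ⟩
    A 0 + (∑ (suc n) (A ∘ suc) + ∑ (suc n) B)         ≡⟨ cong (λ a → A 0 + a) (∑-distrib-+ (suc n) (A ∘ suc) B) ⟨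
    A 0 + ∑ (suc n) (λ i → A (suc i) + B i)           ≡⟨ cong (λ a → A 0 + a) (∑-cong (suc n) pascal) ⟩
    A 0 + ∑ (suc n) (λ i → + (suc n C suc i) * Δ^ (suc i) u x)  ≡⟨ ∑-suc (suc n) (λ i → + (suc n C i) * Δ^ i u x) ⟨
    ∑ (suc (suc n)) (λ i → + (suc n C i) * Δ^ i u x)  ∎
    where
    open ≡-Reasoning
    A B : Sequence
    A i = + (n C i) * Δ^ i u x
    B i = + (n C i) * Δ^ (suc i) u x
    split : ∀ a b c → a * b ≡ a * c + a * (b - c)
    split = solve-∀
    -- The sum of `A` may be lengthened by this zero term; once `A 0` is split off, it pairs with
    -- the sum of `B` term by term, as Pascal's rule requires.
    top : A (suc n) ≡ 0ℤ
    top = trans (cong (λ a → + a * Δ^ (suc n) u x) (k>n⇒nCk≡0 (ℕₚ.n<1+n n))) (ℤₚ.*-zeroˡ (Δ^ (suc n) u x))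
    pascal : ∀ i → A (suc i) + B i ≡ + (suc n C suc i) * Δ^ (suc i) u x
    pascal i = begin
      + (n C suc i) * d + + (n C i) * d  ≡⟨ ℤₚ.*-distribʳ-+ d (+ (n C suc i)) (+ (n C i)) ⟨
      + (n C suc i ℕ.+ n C i) * d        ≡⟨ cong (λ a → + a * d) (ℕₚ.+-comm (n C suc i) (n C i)) ⟩
      + (n C i ℕ.+ n C suc i) * d        ≡⟨ cong (λ a → + a * d) (nCk+nC[k+1]≡[n+1]C[k+1] n i) ⟩
      + (suc n C suc i) * d              ∎
      where d = Δ^ (suc i) u x

  module _ {q : ℕ} (q-prime : Prime q) where
    private instance _ = prime⇒nonZero q-prime

    -- Only the two extreme terms of Newton's formula are not divisible by q, and by
    -- periodicity the first of them is the left-hand side.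
    q∣Δ^[q^j] : ∀ j {u} → Periodic (q ℕ.^ j) u → ∀ x → + q ∣ Δ^ (q ℕ.^ j) u x
    q∣Δ^[q^j] j {u} per x with q ℕ.^ j in eq | ℕₚ.m^n≢0 q j
    ... | n@(suc m) | _ = subst (+ q ∣_) isolate (∣m⇒∣-m q∣middle)
      where
      open ≡-Reasoning
      a : Sequence
      a i = + (n C i) * Δ^ i u x
      q∣middle : + q ∣ ∑ m (a ∘ suc)
      q∣middle = ∣-∑ m λ {i} i<m → ∣m⇒∣m*n {m = + (n C suc i)} (Δ^ (suc i) u x)
        (∣ᵤ⇒∣ (subst (λ y → q ℕ∣.∣ (y C suc i)) eq
          (Binomial.q∣q^jCk q-prime j ℕ.z<s (subst (suc i ℕ.<_) (sym eq) (ℕ.s<s i<m)))))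
      lhs : ∀ a b → - b ≡ a - a - b
      lhs = solve-∀
      rhs : ∀ a b c → a + b + c - a - b ≡ c
      rhs = solve-∀
      expand : u x ≡ u x + ∑ m (a ∘ suc) + Δ^ n u x
      expand = begin
        u x                                 ≡⟨ per x ⟨
        u (x ℕ.+ n)                         ≡⟨ newton n u x ⟩
        ∑ n a + a n                         ≡⟨ cong (_+ a n) (∑-suc m a) ⟩
        a 0 + ∑ m (a ∘ suc) + a n           ≡⟨ cong₂ (λ y z → y + ∑ m (a ∘ suc) + z)
                                                 (ℤₚ.*-identityˡ (u x))
                                                 (trans (cong (λ y → + y * Δ^ n u x) (nCn≡1 n)) (ℤₚ.*-identityˡ (Δ^ n u x))) ⟩
        u x + ∑ m (a ∘ suc) + Δ^ n u x      ∎
      isolate : - ∑ m (a ∘ suc) ≡ Δ^ n u x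
      isolate = begin
        - ∑ m (a ∘ suc)                                             ≡⟨ lhs (u x) _ ⟩
        u x - u x - ∑ m (a ∘ suc)                                   ≡⟨ cong (λ y → y - u x - ∑ m (a ∘ suc)) expand ⟩
        u x + ∑ m (a ∘ suc) + Δ^ n u x - u x - ∑ m (a ∘ suc)        ≡⟨ rhs (u x) _ _ ⟩
        Δ^ n u x                                                    ∎

    -- The quotient of `Δ^ (q ^ j) u` by `q` again has period `q ^ j`, so every further block of
    -- `q ^ j` differences yields another factor `q`.
    q^b∣Δ^[b*q^j] : ∀ j b {u} → Periodic (q ℕ.^ j) u → ∀ x → + (q ℕ.^ b) ∣ Δ^ (b ℕ.* q ℕ.^ j) u x
    q^b∣Δ^[b*q^j] j zero    {u} per x = divides (u x) (sym (ℤₚ.*-identityʳ (u x)))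
    q^b∣Δ^[b*q^j] j (suc b) {u} per x = subst₂ _∣_ (sym (ℤₚ.pos-* q (q ℕ.^ b))) (sym Δ^u≡q*Δ^w)
      (*-monoʳ-∣ (+ q) (q^b∣Δ^[b*q^j] j b w-per x))
      where
      open ≡-Reasoning
      w : Sequence
      w y = _∣_.quotient (q∣Δ^[q^j] j per y)
      Δ^u≡q*w : ∀ y → Δ^ (q ℕ.^ j) u y ≡ + q * w y
      Δ^u≡q*w y = trans (_∣_.equality (q∣Δ^[q^j] j per y)) (ℤₚ.*-comm (w y) (+ q))
      w-per : Periodic (q ℕ.^ j) w
      w-per y = ℤₚ.*-cancelˡ-≡ (+ q) _ _ (begin
        + q * w (y ℕ.+ q ℕ.^ j)               ≡⟨ Δ^u≡q*w _ ⟨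
        Δ^ (q ℕ.^ j) u (y ℕ.+ q ℕ.^ j)        ≡⟨ periodic-Δ^ (q ℕ.^ j) per y ⟩
        Δ^ (q ℕ.^ j) u y                      ≡⟨ Δ^u≡q*w y ⟩
        + q * w y                             ∎)
      Δ^u≡q*Δ^w : Δ^ (q ℕ.^ j ℕ.+ b ℕ.* q ℕ.^ j) u x ≡ + q * Δ^ (b ℕ.* q ℕ.^ j) w x
      Δ^u≡q*Δ^w = begin
        Δ^ (q ℕ.^ j ℕ.+ b ℕ.* q ℕ.^ j) u x    ≡⟨ cong (λ y → Δ^ y u x) (ℕₚ.+-comm (q ℕ.^ j) _) ⟩
        Δ^ (b ℕ.* q ℕ.^ j ℕ.+ q ℕ.^ j) u x    ≡⟨ Δ^-+ (b ℕ.* q ℕ.^ j) (q ℕ.^ j) u x ⟩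
        Δ^ (b ℕ.* q ℕ.^ j) (Δ^ (q ℕ.^ j) u) x ≡⟨ Δ^-cong (b ℕ.* q ℕ.^ j) Δ^u≡q*w x ⟩
        Δ^ (b ℕ.* q ℕ.^ j) (λ y → + q * w y) x ≡⟨ Δ^-* (b ℕ.* q ℕ.^ j) (+ q) w x ⟩
        + q * Δ^ (b ℕ.* q ℕ.^ j) w x          ∎

open Sequences

-- Periodic sequences and their cyclic correlation.

module PeriodicSequences where
  open import Data.Integer
    using (ℤ; +_; 0ℤ; 1ℤ; _+_; _*_; -_; _-_; ∣_∣)
  open import Data.Integer.Properties as ℤₚ using ()
  open import Data.Integer.Divisibility.Signed
  open import Data.Integer.Tactic.RingSolver using (solve-∀)

  ∑-distrib-- : ∀ n (u v : Sequence) → ∑ n (λ x → u x - v x) ≡ ∑ n u - ∑ n v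
  ∑-distrib-- n u v = trans (∑-distrib-+ n u (-_ ∘ v)) (cong (λ a → ∑ n u + a) (begin
    ∑ n (-_ ∘ v)            ≡⟨ ∑-cong n (λ x → ℤₚ.-1*i≡-i (v x)) ⟨
    ∑ n (λ x → - 1ℤ * v x)  ≡⟨ *-distribˡ-∑ n (- 1ℤ) v ⟩
    - 1ℤ * ∑ n v            ≡⟨ ℤₚ.-1*i≡-i (∑ n v) ⟩
    - ∑ n v                 ∎))
    where open ≡-Reasoning

  indicator : ∀ {A : Set} → Dec A → ℤ
  indicator (yes _) = 1ℤ
  indicator (no  _) = 0ℤ

  𝟙 : ℕ → Sequence
  𝟙 n x = indicator (n ℕ∣.∣? x)

  𝟙-∣ : ∀ {n x} → n ℕ∣.∣ x → 𝟙 n x ≡ 1ℤ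
  𝟙-∣ {n} {x} n∣x with n ℕ∣.∣? x
  ... | yes _  = refl
  ... | no n∤x = contradiction n∣x n∤x

  𝟙-∤ : ∀ {n x} → ¬ n ℕ∣.∣ x → 𝟙 n x ≡ 0ℤ
  𝟙-∤ {n} {x} n∤x with n ℕ∣.∣? x
  ... | yes n∣x = contradiction n∣x n∤x
  ... | no _    = refl

  𝟙-periodic : ∀ n → Periodic n (𝟙 n)
  𝟙-periodic n x with n ℕ∣.∣? x
  ... | yes n∣x = 𝟙-∣ (ℕ∣.∣m∣n⇒∣m+n n∣x ℕ∣.∣-refl)
  ... | no  n∤x = 𝟙-∤ (λ n∣x+n → n∤x (ℕ∣.∣m+n∣m⇒∣n (subst (n ℕ∣.∣_) (ℕₚ.+-comm x n) n∣x+n) ℕ∣.∣-refl))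

  ∑-𝟙 : ∀ n .{{_ : ℕ.NonZero n}} (u : Sequence) → ∑ n (λ y → 𝟙 n y * u y) ≡ u 0
  ∑-𝟙 (suc m) u = begin
    ∑ (suc m) (λ y → 𝟙 (suc m) y * u y)             ≡⟨ ∑-suc m (λ y → 𝟙 (suc m) y * u y) ⟩
    𝟙 (suc m) 0 * u 0 + ∑ m (λ y → 𝟙 (suc m) (suc y) * u (suc y))
      ≡⟨ cong₂ _+_ (trans (cong (_* u 0) (𝟙-∣ (suc m ℕ∣.∣0))) (ℤₚ.*-identityˡ (u 0)))
                   (trans (∑-cong-< m off) (trans (∑-const m 0ℤ) (ℤₚ.*-zeroʳ (+ m)))) ⟩
    u 0 + 0ℤ                                        ≡⟨ ℤₚ.+-identityʳ (u 0) ⟩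
    u 0                                             ∎
    where
    open ≡-Reasoning
    off : ∀ {y} → y ℕ.< m → 𝟙 (suc m) (suc y) * u (suc y) ≡ 0ℤ
    off {y} y<m = trans (cong (_* u (suc y)) (𝟙-∤ (λ d → ℕₚ.<⇒≱ (ℕ.s<s y<m) (ℕ∣.∣⇒≤ d)))) (ℤₚ.*-zeroˡ (u (suc y)))

  ∑-𝟙′ : ∀ n .{{_ : ℕ.NonZero n}} → ∑ n (𝟙 n) ≡ 1ℤ
  ∑-𝟙′ n = trans (∑-cong n (λ y → sym (ℤₚ.*-identityʳ (𝟙 n y)))) (∑-𝟙 n (λ _ → 1ℤ))

  periodic-∑ : ∀ {n v} → ∑ n v ≡ 0ℤ → Periodic n v → Periodic n (λ x → ∑ x v)
  periodic-∑ {n} {v} ∑v≡0 per x = begin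
    ∑ (x ℕ.+ n) v                          ≡⟨ cong (λ m → ∑ m v) (ℕₚ.+-comm x n) ⟩
    ∑ (n ℕ.+ x) v                          ≡⟨ ∑-+ n x v ⟩
    ∑ n v + ∑ x (λ y → v (n ℕ.+ y))        ≡⟨ cong₂ _+_ ∑v≡0 (∑-cong x (λ y → trans (cong v (ℕₚ.+-comm n y)) (per y))) ⟩
    0ℤ + ∑ x v                             ≡⟨ ℤₚ.+-identityˡ _ ⟩
    ∑ x v                                  ∎
    where open ≡-Reasoning

  periodic-% : ∀ {n u} .{{_ : ℕ.NonZero n}} → Periodic n u → ∀ x → u x ≡ u (x ℕ/.% n)
  periodic-% {n} {u} per x = trans (cong u (ℕ/.m≡m%n+[m/n]*n x n)) (periodic-* (x ℕ/./ n) per (x ℕ/.% n))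

  periodic-bounded : ∀ {n u} .{{_ : ℕ.NonZero n}} → Periodic n u → ∃[ b ] ∀ x → ∣ u x ∣ ℕ.≤ b
  periodic-bounded {n} {u} per = proj₁ (below n) , λ x →
    subst (λ a → ∣ a ∣ ℕ.≤ proj₁ (below n)) (sym (periodic-% per x)) (proj₂ (below n) (ℕ/.m%n<n x n))
    where
    below : ∀ m → ∃[ b ] ∀ {x} → x ℕ.< m → ∣ u x ∣ ℕ.≤ b
    below zero    = 0 , λ ()
    below (suc m) with b , bound ← below m = b ℕ.⊔ ∣ u m ∣ , λ x<1+m →
      [ (λ x<m → ℕₚ.≤-trans (bound x<m) (ℕₚ.m≤m⊔n b _)) , (λ { refl → ℕₚ.m≤n⊔m b _ }) ]′
      (ℕₚ.m≤n⇒m<n∨m≡n (ℕ.s≤s⁻¹ x<1+m))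

  periodic-resp-≗ : ∀ {n u v} → u ≗ v → Periodic n u → Periodic n v
  periodic-resp-≗ u≗v per x = trans (sym (u≗v _)) (trans (per x) (u≗v x))

  n<q^n : ∀ {q} → 2 ℕ.≤ q → ∀ n → n ℕ.< q ℕ.^ n
  n<q^n 2≤q zero = ℕ.z<s
  n<q^n {q} 2≤q (suc n) = begin-strict
    suc n                  ≤⟨ n<q^n 2≤q n ⟩
    q ℕ.^ n                <⟨ ℕₚ.m<m+n (q ℕ.^ n) (ℕₚ.≤-<-trans ℕ.z≤n (n<q^n 2≤q n)) ⟩
    q ℕ.^ n ℕ.+ q ℕ.^ n    ≡⟨ cong (λ a → q ℕ.^ n ℕ.+ a) (ℕₚ.+-identityʳ _) ⟨
    2 ℕ.* q ℕ.^ n          ≤⟨ ℕₚ.*-monoˡ-≤ (q ℕ.^ n) 2≤q ⟩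
    q ℕ.* q ℕ.^ n          ∎
    where open ℕₚ.≤-Reasoning

  ∣∧small⇒≡0 : ∀ {n a} → + n ∣ a → ∣ a ∣ ℕ.< n → a ≡ 0ℤ
  ∣∧small⇒≡0 {n} {a} n∣a ∣a∣<n = ℤₚ.∣i∣≡0⇒i≡0 (help (∣⇒∣ᵤ n∣a) ∣a∣<n)
    where
    help : ∀ {m} → n ℕ∣.∣ m → m ℕ.< n → m ≡ 0
    help {zero}  _   _   = refl
    help {suc m} n∣m m<n = contradiction (ℕ∣.∣⇒≤ n∣m) (ℕₚ.<⇒≱ m<n)

  module Correlation (n : ℕ) where
    infixl 7 _⋆_
    -- Correlation instead of convolution, because the index `x + y` needs no subtraction in ℕ.
    _⋆_ : Sequence → Sequence → Sequence
    (p ⋆ h) x = ∑ n (λ y → p y * h (x ℕ.+ y))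

    ⋆-distribʳ-- : ∀ p r h x → ((λ y → p y - r y) ⋆ h) x ≡ (p ⋆ h) x - (r ⋆ h) x
    ⋆-distribʳ-- p r h x = trans (∑-cong n (λ y → distrib (p y) (r y) (h (x ℕ.+ y))))
                                 (∑-distrib-- n (λ y → p y * h (x ℕ.+ y)) (λ y → r y * h (x ℕ.+ y)))
      where
      distrib : ∀ a b c → (a - b) * c ≡ a * c - b * c
      distrib = solve-∀

    ⋆-distribˡ-- : ∀ p h g x → (p ⋆ (λ y → h y - g y)) x ≡ (p ⋆ h) x - (p ⋆ g) x
    ⋆-distribˡ-- p h g x = trans (∑-cong n (λ y → distrib (p y) (h (x ℕ.+ y)) (g (x ℕ.+ y))))
                                 (∑-distrib-- n (λ y → p y * h (x ℕ.+ y)) (λ y → p y * g (x ℕ.+ y)))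
      where
      distrib : ∀ a b c → a * (b - c) ≡ a * b - a * c
      distrib = solve-∀

    ⋆-Δ : ∀ p h → p ⋆ Δ h ≗ Δ (p ⋆ h)
    ⋆-Δ p h = ⋆-distribˡ-- p (h ∘ suc) h

    ⋆-periodicʳ : ∀ {m} p {h} → Periodic m h → Periodic m (p ⋆ h)
    ⋆-periodicʳ {m} p {h} per x = ∑-cong n λ y → cong (p y *_)
      (trans (cong h (move x y)) (per (x ℕ.+ y)))
      where
      move : ∀ x y → x ℕ.+ m ℕ.+ y ≡ x ℕ.+ y ℕ.+ m
      move x y = trans (ℕₚ.+-assoc x m y) (trans (cong (x ℕ.+_) (ℕₚ.+-comm m y)) (sym (ℕₚ.+-assoc x y m)))

    ⋆-shift : ∀ {p h} → Periodic n p → Periodic n h →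
              ∀ d x → ∑ n (λ y → p (y ℕ.+ d) * h (x ℕ.+ d ℕ.+ y)) ≡ (p ⋆ h) x
    ⋆-shift {p} {h} p-per h-per d x = trans
      (∑-cong n (λ y → cong (λ z → p (y ℕ.+ d) * h z) (trans (ℕₚ.+-assoc x d y) (cong (x ℕ.+_) (ℕₚ.+-comm d y)))))
      (∑-shift w-per d)
      where
      w-per : Periodic n (λ y → p y * h (x ℕ.+ y))
      w-per y = cong₂ _*_ (p-per y) (trans (cong h (sym (ℕₚ.+-assoc x y n))) (h-per (x ℕ.+ y)))

    -- Translating both factors by `m` only reindexes a sum over a full period, and the translation
    -- of `p` is invisible.
    ⋆-periodicˡ : ∀ {m p h} → Periodic m p → Periodic n p → Periodic n h → Periodic m (p ⋆ h)
    ⋆-periodicˡ {m} {p} {h} p-perₘ p-per h-per x = trans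
      (∑-cong n (λ y → cong (_* _) (sym (p-perₘ y))))
      (⋆-shift p-per h-per m x)

    -- Summation by parts. Translating `p` forwards translates the correlation backwards: hence the
    -- sign, and `suc x` on the left.
    Δ-⋆ : ∀ {p h} → Periodic n p → Periodic n h → ∀ x → (Δ p ⋆ h) (suc x) ≡ - Δ (p ⋆ h) x
    Δ-⋆ {p} {h} p-per h-per x = begin
      (Δ p ⋆ h) (suc x)                              ≡⟨ ⋆-distribʳ-- (p ∘ suc) p h (suc x) ⟩
      ((p ∘ suc) ⋆ h) (suc x) - (p ⋆ h) (suc x)      ≡⟨ cong (_- (p ⋆ h) (suc x)) (begin
        ((p ∘ suc) ⋆ h) (suc x)                          ≡⟨ ∑-cong n (λ y → cong₂ (λ a b → p a * h (b ℕ.+ y)) (ℕₚ.+-comm 1 y) (ℕₚ.+-comm 1 x)) ⟩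
        ∑ n (λ y → p (y ℕ.+ 1) * h (x ℕ.+ 1 ℕ.+ y))     ≡⟨ ⋆-shift p-per h-per 1 x ⟩
        (p ⋆ h) x                                        ∎) ⟩
      (p ⋆ h) x - (p ⋆ h) (suc x)                    ≡⟨ flip ((p ⋆ h) x) ((p ⋆ h) (suc x)) ⟩
      - Δ (p ⋆ h) x                                  ∎
      where
      open ≡-Reasoning
      flip : ∀ a b → a - b ≡ - (b - a)
      flip = solve-∀

    ∑-⋆ : ∀ p {h} → Periodic n h → ∑ n (p ⋆ h) ≡ ∑ n p * ∑ n h
    ∑-⋆ p {h} h-per = begin
      ∑ n (λ x → ∑ n (λ y → p y * h (x ℕ.+ y)))  ≡⟨ ∑-comm n n (λ x y → p y * h (x ℕ.+ y)) ⟩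
      ∑ n (λ y → ∑ n (λ x → p y * h (x ℕ.+ y)))  ≡⟨ ∑-cong n (λ y → trans (*-distribˡ-∑ n (p y) (λ x → h (x ℕ.+ y))) (trans (cong (p y *_) (∑-shift h-per y)) (ℤₚ.*-comm (p y) (∑ n h)))) ⟩
      ∑ n (λ y → ∑ n h * p y)                    ≡⟨ *-distribˡ-∑ n (∑ n h) p ⟩
      ∑ n h * ∑ n p                              ≡⟨ ℤₚ.*-comm (∑ n h) (∑ n p) ⟩
      ∑ n p * ∑ n h                              ∎
      where open ≡-Reasoning

  -- Multiplication by ζ - 1 is injective modulo sequences of period `k`. The increment of `u` over
  -- `k` steps is constant because `Δ u` has period `k`, and `q` such increments lead back to the
  -- start, so it is zero.
  periodic-Δ⁻¹ : ∀ q .{{_ : ℕ.NonZero q}} {k u} → Periodic (q ℕ.* k) u → Periodic k (Δ u) → Periodic k u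
  periodic-Δ⁻¹ q {k} {u} per Δ-per x = ℤₚ.i-j≡0⇒i≡j (u (x ℕ.+ k)) (u x) (trans (d-const x) d0≡0)
    where
    open ≡-Reasoning
    d : Sequence
    d x = u (x ℕ.+ k) - u x
    rearrange : ∀ a b c e → a - b ≡ (a - c) - (b - e) + (c - e)
    rearrange = solve-∀
    d-const : ∀ x → d x ≡ d 0
    d-const zero    = refl
    d-const (suc x) = begin
      u (suc x ℕ.+ k) - u (suc x)                       ≡⟨ rearrange (u (suc x ℕ.+ k)) (u (suc x)) (u (x ℕ.+ k)) (u x) ⟩
      Δ u (x ℕ.+ k) - Δ u x + d x                       ≡⟨ cong (_+ d x) (ℤₚ.i≡j⇒i-j≡0 (Δ-per x)) ⟩
      0ℤ + d x                                          ≡⟨ ℤₚ.+-identityˡ (d x) ⟩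
      d x                                               ≡⟨ d-const x ⟩
      d 0                                               ∎
    telescope : ∀ a b → a ≡ (a - b) + b
    telescope = solve-∀
    walk : ∀ i → u (i ℕ.* k) ≡ + i * d 0 + u 0
    walk zero    = sym (trans (cong (_+ u 0) (ℤₚ.*-zeroˡ (d 0))) (ℤₚ.+-identityˡ (u 0)))
    walk (suc i) = begin
      u (k ℕ.+ i ℕ.* k)                ≡⟨ cong u (ℕₚ.+-comm k (i ℕ.* k)) ⟩
      u (i ℕ.* k ℕ.+ k)                ≡⟨ telescope (u (i ℕ.* k ℕ.+ k)) (u (i ℕ.* k)) ⟩
      d (i ℕ.* k) + u (i ℕ.* k)        ≡⟨ cong₂ _+_ (d-const (i ℕ.* k)) (walk i) ⟩
      d 0 + (+ i * d 0 + u 0)          ≡⟨ ℤₚ.+-assoc (d 0) _ _ ⟨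
      d 0 + + i * d 0 + u 0            ≡⟨ cong (_+ u 0) (ℤₚ.suc-* (+ i) (d 0)) ⟨
      + suc i * d 0 + u 0              ∎
    cancelʳ : ∀ a b → a ≡ a + b - b
    cancelʳ = solve-∀
    d0≡0 : d 0 ≡ 0ℤ
    d0≡0 = ℤₚ.*-cancelˡ-≡ (+ q) (d 0) 0ℤ (begin
      + q * d 0                  ≡⟨ cancelʳ (+ q * d 0) (u 0) ⟩
      + q * d 0 + u 0 - u 0      ≡⟨ cong (_- u 0) (walk q) ⟨
      u (q ℕ.* k) - u 0          ≡⟨ ℤₚ.i≡j⇒i-j≡0 (per 0) ⟩
      0ℤ                         ≡⟨ ℤₚ.*-zeroʳ (+ q) ⟨
      + q * 0ℤ                   ∎)

open PeriodicSequences

-- Modulo sequences of period q ^ j, the sequences of period q ^ (1 + j) form ℤ[ζ]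
-- for a primitive q ^ (1 + j)-th root of unity ζ, and ⋆ becomes its multiplication
-- up to the conjugation ζ ↦ ζ⁻¹.  Every nonzero element is divisible by ζ - 1 only
-- finitely often, as a power of ζ - 1 is divisible by q; and the residue field of
-- ζ - 1 is ℤ/q, reached by the sum over a period.  So `primality` holds: ℤ[ζ] is a domain.
module Cyclotomic {q : ℕ} (q-prime : Prime q) (j : ℕ) where
  open import Data.Integer
    using (+_; 0ℤ; 1ℤ; _+_; _*_; -_; _-_; ∣_∣)
  open import Data.Integer.Properties as ℤₚ using ()
  open import Data.Integer.Divisibility.Signed
  open import Data.Integer.Tactic.RingSolver using (solve-∀)

  private instance _ = prime⇒nonZero q-prime

  K M : ℕ
  K = q ℕ.^ j
  M = q ℕ.^ suc j

  private instance
    _ = ℕₚ.m^n≢0 q j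
    _ = ℕₚ.m^n≢0 q (suc j)

  open Correlation M

  periodicᴹ : ∀ {u} → Periodic K u → Periodic M u
  periodicᴹ = periodic-* q

  -- Division by ζ - 1.
  antidifference : ∀ {p} → Periodic M p → + q ∣ ∑ M p →
                   ∃[ r ] Periodic M r × Periodic K (λ x → p x - Δ r x)
  antidifference {p} p-per (divides z ∑p≡z*q) =
    (λ x → ∑ x v) , periodic-∑ ∑v≡0 v-per , periodic-resp-≗ (λ x → sym (cancel (p x) (κ x) (∑ x v))) κ-per
    where
    open ≡-Reasoning
    κ v : Sequence
    -- A mass `z` at each multiple of `K` totals `z * q` over the period `M`. Removing it makes the
    -- sum of `p` zero, so that partial sums are periodic, and changes `p` only by a sequence of
    -- period `K`.
    κ x = z * 𝟙 K x
    v x = p x - κ x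
    κ-per : Periodic K κ
    κ-per x = cong (z *_) (𝟙-periodic K x)
    v-per : Periodic M v
    v-per x = cong₂ _-_ (p-per x) (periodicᴹ κ-per x)
    ∑v≡0 : ∑ M v ≡ 0ℤ
    ∑v≡0 = begin
      ∑ M v                           ≡⟨ ∑-distrib-- M p κ ⟩
      ∑ M p - ∑ M κ                   ≡⟨ cong (λ a → ∑ M p - a) (begin
        ∑ M κ                             ≡⟨ ∑-periodic q κ-per ⟩
        + q * ∑ K κ                       ≡⟨ cong (+ q *_) (*-distribˡ-∑ K z (𝟙 K)) ⟩
        + q * (z * ∑ K (𝟙 K))             ≡⟨ cong (λ a → + q * (z * a)) (∑-𝟙′ K) ⟩
        + q * (z * 1ℤ)                    ≡⟨ cong (+ q *_) (ℤₚ.*-identityʳ z) ⟩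
        + q * z                           ≡⟨ ℤₚ.*-comm (+ q) z ⟩
        z * + q                           ∎) ⟩
      ∑ M p - z * + q                 ≡⟨ ℤₚ.i≡j⇒i-j≡0 ∑p≡z*q ⟩
      0ℤ                              ∎
    cancel : ∀ a b c → a - (c + (a - b) - c) ≡ b
    cancel = solve-∀

  -- Up to sign and an offset, `Δ (r ⋆ h)` is `p ⋆ h` minus a correlation with the remainder
  -- `p - Δ r`. Both have period `K`, and `Δ` can be cancelled.
  ⋆-divideˡ : ∀ {p r h} → Periodic M p → Periodic M r → Periodic M h →
              Periodic K (λ x → p x - Δ r x) → Periodic K (p ⋆ h) → Periodic K (r ⋆ h)
  ⋆-divideˡ {p} {r} {h} p-per r-per h-per rem-per ⋆-per =
    periodic-Δ⁻¹ q (⋆-periodicʳ r h-per) (periodic-resp-≗ eq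
      (λ x → cong₂ _-_ (⋆-periodicˡ rem-per (periodicᴹ rem-per) h-per (suc x)) (⋆-per (suc x))))
    where
    open ≡-Reasoning
    κ : Sequence
    κ x = p x - Δ r x
    simplify : ∀ a b → a - b - a ≡ - b
    simplify = solve-∀
    eq : ∀ x → (κ ⋆ h) (suc x) - (p ⋆ h) (suc x) ≡ Δ (r ⋆ h) x
    eq x = begin
      (κ ⋆ h) (suc x) - (p ⋆ h) (suc x)                       ≡⟨ cong (_- (p ⋆ h) (suc x)) (⋆-distribʳ-- p (Δ r) h (suc x)) ⟩
      (p ⋆ h) (suc x) - (Δ r ⋆ h) (suc x) - (p ⋆ h) (suc x)   ≡⟨ simplify ((p ⋆ h) (suc x)) _ ⟩
      - (Δ r ⋆ h) (suc x)                                     ≡⟨ cong -_ (Δ-⋆ r-per h-per x) ⟩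
      - - Δ (r ⋆ h) x                                         ≡⟨ ℤₚ.neg-involutive _ ⟩
      Δ (r ⋆ h) x                                             ∎

  ⋆-divideʳ : ∀ {p h r} → Periodic M r →
              Periodic K (λ x → h x - Δ r x) → Periodic K (p ⋆ h) → Periodic K (p ⋆ r)
  ⋆-divideʳ {p} {h} {r} r-per rem-per ⋆-per =
    periodic-Δ⁻¹ q (⋆-periodicʳ p r-per) (periodic-resp-≗ eq
      (λ x → cong₂ _-_ (⋆-per x) (⋆-periodicʳ p rem-per x)))
    where
    open ≡-Reasoning
    κ : Sequence
    κ x = h x - Δ r x
    simplify : ∀ a b → a - (a - b) ≡ b
    simplify = solve-∀
    eq : ∀ x → (p ⋆ h) x - (p ⋆ κ) x ≡ Δ (p ⋆ r) x
    eq x = begin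
      (p ⋆ h) x - (p ⋆ κ) x                         ≡⟨ cong (λ a → (p ⋆ h) x - a) (⋆-distribˡ-- p h (Δ r) x) ⟩
      (p ⋆ h) x - ((p ⋆ h) x - (p ⋆ Δ r) x)         ≡⟨ simplify ((p ⋆ h) x) _ ⟩
      (p ⋆ Δ r) x                                   ≡⟨ ⋆-Δ p r x ⟩
      Δ (p ⋆ r) x                                   ∎

  -- Divisibility by the `n`-th power of ζ - 1, where sequences of period `K` count as zero.
  Divisible : ℕ → Sequence → Set
  Divisible n p = ∃[ r ] Periodic M r × Periodic K (λ x → p x - Δ^ n r x)

  divisible-suc : ∀ n {p r} → Periodic K (λ x → p x - Δ r x) → Divisible n r → Divisible (suc n) p
  divisible-suc n {p} {r} p-Δr (t , t-per , r-Δ^t) = t , t-per , periodic-resp-≗ eq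
    (λ x → cong₂ _+_ (p-Δr x) (cong₂ _-_ (r-Δ^t (suc x)) (r-Δ^t x)))
    where
    regroup : ∀ a r₁ r₀ t₁ t₀ → a - (r₁ - r₀) + (r₁ - t₁ - (r₀ - t₀)) ≡ a - (t₁ - t₀)
    regroup = solve-∀
    eq : ∀ x → p x - Δ r x + Δ (λ y → r y - Δ^ n t y) x ≡ p x - Δ^ (suc n) t x
    eq x = regroup (p x) (r (suc x)) (r x) (Δ^ n t (suc x)) (Δ^ n t x)

  divisible-zero : ∀ {p} → Periodic M p → Divisible 0 p
  divisible-zero {p} p-per = p , p-per , λ x → trans (ℤₚ.i≡j⇒i-j≡0 {p (x ℕ.+ K)} refl) (sym (ℤₚ.i≡j⇒i-j≡0 {p x} refl))

  -- The period sum turns `⋆` into a product, and the sum of `p ⋆ h` over `M` consists of `q` equal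
  -- blocks. Euclid's lemma chooses the factor.
  q∣∑⊎q∣∑ : ∀ {p h} → Periodic M h → Periodic K (p ⋆ h) → (+ q ∣ ∑ M p) ⊎ (+ q ∣ ∑ M h)
  q∣∑⊎q∣∑ {p} {h} h-per ⋆-per = Sum.map ∣ᵤ⇒∣ ∣ᵤ⇒∣ (euclidsLemma ∣ ∑ M p ∣ ∣ ∑ M h ∣ q-prime
    (subst (q ℕ∣.∣_) (ℤₚ.abs-* (∑ M p) (∑ M h)) (∣⇒∣ᵤ q∣∑*∑)))
    where
    q∣∑*∑ : + q ∣ ∑ M p * ∑ M h
    q∣∑*∑ = subst (+ q ∣_) (trans (sym (∑-periodic q ⋆-per)) (∑-⋆ p h-per)) (∣m⇒∣m*n (∑ K (p ⋆ h)) ∣-refl)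

  -- Each round cancels one factor ζ - 1 from `p` or from `h`. The counters hold the factors still
  -- wanted; one of them runs out first, so no exact valuation has to be computed.
  descend : ∀ m n {p h} → Periodic M p → Periodic M h → Periodic K (p ⋆ h) →
            Divisible m p ⊎ Divisible n h
  descend zero    n       p-per h-per ⋆-per = inj₁ (divisible-zero p-per)
  descend (suc m) zero    p-per h-per ⋆-per = inj₂ (divisible-zero h-per)
  descend (suc m) (suc n) {p} {h} p-per h-per ⋆-per with q∣∑⊎q∣∑ {p} h-per ⋆-per
  ... | inj₁ q∣∑p with r , r-per , p-Δr ← antidifference p-per q∣∑p =
        Sum.map₁ (divisible-suc m {p} {r} p-Δr)
          (descend m (suc n) r-per h-per (⋆-divideˡ p-per r-per h-per p-Δr ⋆-per))
  ... | inj₂ q∣∑h with r , r-per , h-Δr ← antidifference h-per q∣∑h =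
        Sum.map₂ (divisible-suc n {h} {r} h-Δr)
          (descend (suc m) n p-per r-per (⋆-divideʳ {p} {h} r-per h-Δr ⋆-per))

  -- A quantitative form of the finiteness of the valuation: `b * M` differences supply the factor
  -- `q ^ b`, and an increment of `p` over `K` steps, where the remainder of period `K` cancels, is
  -- at most `b` and hence smaller than `q ^ b`.
  divisible⇒periodic : ∀ {p} b → (∀ x → ∣ p (x ℕ.+ K) - p x ∣ ℕ.≤ b) → Divisible (b ℕ.* M) p → Periodic K p
  divisible⇒periodic {p} b bound (r , r-per , p-Δ^r) x =
    ℤₚ.i-j≡0⇒i≡j (p (x ℕ.+ K)) (p x) (∣∧small⇒≡0 {q ℕ.^ b} q^b∣dp
      (ℕₚ.≤-<-trans (bound x) (n<q^n (ℕ.nonTrivial⇒n>1 q {{prime⇒nonTrivial q-prime}}) b)))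
    where
    d : Sequence
    d = Δ^ (b ℕ.* M) r
    regroup : ∀ a₁ a₀ d₁ d₀ → a₁ - a₀ ≡ (a₁ - d₁) - (a₀ - d₀) + (d₁ - d₀)
    regroup = solve-∀
    eq : d (x ℕ.+ K) - d x ≡ p (x ℕ.+ K) - p x
    eq = sym (trans (regroup (p (x ℕ.+ K)) (p x) (d (x ℕ.+ K)) (d x))
      (trans (cong (_+ (d (x ℕ.+ K) - d x)) (ℤₚ.i≡j⇒i-j≡0 (p-Δ^r x))) (ℤₚ.+-identityˡ _)))
    q^b∣dp : + (q ℕ.^ b) ∣ p (x ℕ.+ K) - p x
    q^b∣dp = subst (+ (q ℕ.^ b) ∣_) eq
      (∣m∣n⇒∣m-n (q^b∣Δ^[b*q^j] q-prime (suc j) b r-per (x ℕ.+ K)) (q^b∣Δ^[b*q^j] q-prime (suc j) b r-per x))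

  differences-bounded : ∀ {u} → Periodic M u → ∃[ b ] ∀ x → ∣ u (x ℕ.+ K) - u x ∣ ℕ.≤ b
  differences-bounded {u} u-per = periodic-bounded λ x → cong₂ _-_
    (trans (cong u (trans (ℕₚ.+-assoc x M K) (trans (cong (x ℕ.+_) (ℕₚ.+-comm M K)) (sym (ℕₚ.+-assoc x K M)))))
           (u-per (x ℕ.+ K)))
    (u-per x)

  primality : ∀ {p h} → Periodic M p → Periodic M h → Periodic K (p ⋆ h) → Periodic K p ⊎ Periodic K h
  primality {p} {h} p-per h-per ⋆-per
    with b₁ , bound₁ ← differences-bounded p-per
       | b₂ , bound₂ ← differences-bounded h-per =
    Sum.map (divisible⇒periodic b (λ x → ℕₚ.≤-trans (bound₁ x) (ℕₚ.m≤m+n b₁ b₂)))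
            (divisible⇒periodic b (λ x → ℕₚ.≤-trans (bound₂ x) (ℕₚ.m≤n+m b₂ b₁)))
            (descend (b ℕ.* M) (b ℕ.* M) p-per h-per ⋆-per)
    where b = b₁ ℕ.+ b₂

-- Averages over translates.

module Averaging where
  open import Data.Integer using (+_; _+_; _*_)
  open import Data.Integer.Properties as ℤₚ using ()

  -- Averages, unnormalised so as to stay integral.
  average : ℕ → ℕ → Sequence → Sequence
  average n r h x = ∑ r (λ i → h (x ℕ.+ i ℕ.* n))

  average-periodic : ∀ n r {h} → Periodic (r ℕ.* n) h → Periodic n (average n r h)
  average-periodic n r {h} per x = begin
    ∑ r (λ i → h (x ℕ.+ n ℕ.+ i ℕ.* n))      ≡⟨ ∑-cong r (λ i → cong h (trans (ℕₚ.+-assoc x n (i ℕ.* n)) (cong (λ m → x ℕ.+ m ℕ.* n) (ℕₚ.+-comm 1 i)))) ⟩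
    ∑ r (λ i → h (x ℕ.+ (i ℕ.+ 1) ℕ.* n))    ≡⟨ ∑-shift w-per 1 ⟩
    ∑ r (λ i → h (x ℕ.+ i ℕ.* n))            ∎
    where
    open ≡-Reasoning
    w-per : Periodic r (λ i → h (x ℕ.+ i ℕ.* n))
    w-per i = trans (cong h (trans (cong (x ℕ.+_) (ℕₚ.*-distribʳ-+ n i r)) (sym (ℕₚ.+-assoc x (i ℕ.* n) (r ℕ.* n)))))
                    (per (x ℕ.+ i ℕ.* n))

  ∑-average : ∀ n r h → ∑ n (average n r h) ≡ ∑ (r ℕ.* n) h
  ∑-average n r h = trans (∑-comm n r (λ x i → h (x ℕ.+ i ℕ.* n))) (blocks r)
    where
    open ≡-Reasoning
    blocks : ∀ r → ∑ r (λ i → ∑ n (λ x → h (x ℕ.+ i ℕ.* n))) ≡ ∑ (r ℕ.* n) h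
    blocks zero    = refl
    blocks (suc r) = begin
      ∑ r (λ i → ∑ n (λ x → h (x ℕ.+ i ℕ.* n))) + ∑ n (λ x → h (x ℕ.+ r ℕ.* n))
        ≡⟨ cong₂ _+_ (blocks r) (∑-cong n (λ x → cong h (ℕₚ.+-comm x (r ℕ.* n)))) ⟩
      ∑ (r ℕ.* n) h + ∑ n (λ x → h (r ℕ.* n ℕ.+ x))  ≡⟨ ∑-+ (r ℕ.* n) n h ⟨
      ∑ (r ℕ.* n ℕ.+ n) h                            ≡⟨ cong (λ m → ∑ m h) (ℕₚ.+-comm (r ℕ.* n) n) ⟩
      ∑ (n ℕ.+ r ℕ.* n) h                            ∎

-- Operators given by displacements, and their kernels.

module ShiftOperators where
  open import Data.List using (List; []; _∷_; length)
  open import Data.Integer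
    using (ℤ; +_; 0ℤ; _+_; _*_; -_; _-_; _≤_; +≤+)
  open import Data.Integer.Properties as ℤₚ using ()
  open import Data.Integer.Tactic.RingSolver using (solve-∀)
  open Averaging

  shifts : List ℕ → Sequence → Sequence
  shifts []       h x = 0ℤ
  shifts (d ∷ ds) h x = h (x ℕ.+ d) + shifts ds h x

  shifts-cong : ∀ ds {u v} → u ≗ v → shifts ds u ≗ shifts ds v
  shifts-cong []       u≗v x = refl
  shifts-cong (d ∷ ds) u≗v x = cong₂ _+_ (u≗v (x ℕ.+ d)) (shifts-cong ds u≗v x)

  shifts-∑ : ∀ ds r (u : ℕ → Sequence) x → shifts ds (λ y → ∑ r (λ i → u i y)) x ≡ ∑ r (λ i → shifts ds (u i) x)
  shifts-∑ []       r u x = sym (trans (∑-const r 0ℤ) (ℤₚ.*-zeroʳ (+ r)))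
  shifts-∑ (d ∷ ds) r u x = trans (cong (λ a → ∑ r (λ i → u i (x ℕ.+ d)) + a) (shifts-∑ ds r u x))
                                  (sym (∑-distrib-+ r (λ i → u i (x ℕ.+ d)) (λ i → shifts ds (u i) x)))

  shifts-translate : ∀ ds h m x → shifts ds (λ y → h (y ℕ.+ m)) x ≡ shifts ds h (x ℕ.+ m)
  shifts-translate []       h m x = refl
  shifts-translate (d ∷ ds) h m x = cong₂ _+_ (cong h move) (shifts-translate ds h m x)
    where
    move : x ℕ.+ d ℕ.+ m ≡ x ℕ.+ m ℕ.+ d
    move = trans (ℕₚ.+-assoc x d m) (trans (cong (x ℕ.+_) (ℕₚ.+-comm d m)) (sym (ℕₚ.+-assoc x m d)))

  ∑-shifts : ∀ ds {n h} → Periodic n h → ∑ n (shifts ds h) ≡ + length ds * ∑ n h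
  ∑-shifts []       {n} {h} per = trans (∑-const n 0ℤ) (trans (ℤₚ.*-zeroʳ (+ n)) (sym (ℤₚ.*-zeroˡ (∑ n h))))
  ∑-shifts (d ∷ ds) {n} {h} per = begin
    ∑ n (λ x → h (x ℕ.+ d) + shifts ds h x)          ≡⟨ ∑-distrib-+ n (λ x → h (x ℕ.+ d)) (shifts ds h) ⟩
    ∑ n (λ x → h (x ℕ.+ d)) + ∑ n (shifts ds h)      ≡⟨ cong₂ _+_ (∑-shift per d) (∑-shifts ds per) ⟩
    ∑ n h + + length ds * ∑ n h                      ≡⟨ ℤₚ.suc-* (+ length ds) (∑ n h) ⟨
    + suc (length ds) * ∑ n h                        ∎
    where open ≡-Reasoning

  shifts-mono-≤ : ∀ ds {u v : Sequence} → (∀ x → u x ≤ v x) → ∀ x → shifts ds u x ≤ shifts ds v x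
  shifts-mono-≤ []       u≤v x = ℤₚ.≤-refl
  shifts-mono-≤ (d ∷ ds) u≤v x = ℤₚ.+-mono-≤ (u≤v (x ℕ.+ d)) (shifts-mono-≤ ds u≤v x)

  shifts-const : ∀ ds a x → shifts ds (λ _ → a) x ≡ + length ds * a
  shifts-const []       a x = sym (ℤₚ.*-zeroˡ a)
  shifts-const (d ∷ ds) a x = trans (cong (λ b → a + b) (shifts-const ds a x)) (sym (ℤₚ.suc-* (+ length ds) a))

  0≤𝟙 : ∀ n x → 0ℤ ≤ 𝟙 n x
  0≤𝟙 n x with n ℕ∣.∣? x
  ... | yes _ = +≤+ ℕ.z≤n
  ... | no  _ = ℤₚ.≤-refl

  𝟙-mono-∣ : ∀ {m n} → m ℕ∣.∣ n → ∀ x → 𝟙 n x ≤ 𝟙 m x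
  𝟙-mono-∣ {m} {n} m∣n x with n ℕ∣.∣? x
  ... | yes n∣x = ℤₚ.≤-reflexive (sym (𝟙-∣ (ℕ∣.∣-trans m∣n n∣x)))
  ... | no  _   = 0≤𝟙 m x

  module _ (ds : List ℕ) (μ : ℤ) where

    A : Sequence → Sequence
    A h x = shifts ds h x - μ * h x

    -- `A` is linear and commutes with translations, so each of the `r` translates contributes `c`.
    A-average : ∀ n r {h c} → (∀ x → A h x ≡ c) → ∀ x → A (average n r h) x ≡ + r * c
    A-average n r {h} {c} Ah≡c x = begin
      shifts ds (average n r h) x - μ * average n r h x
        ≡⟨ cong₂ _-_ (shifts-∑ ds r (λ i y → h (y ℕ.+ i ℕ.* n)) x) (sym (*-distribˡ-∑ r μ (λ i → h (x ℕ.+ i ℕ.* n)))) ⟩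
      ∑ r (λ i → shifts ds (λ y → h (y ℕ.+ i ℕ.* n)) x) - ∑ r (λ i → μ * h (x ℕ.+ i ℕ.* n))
        ≡⟨ ∑-distrib-- r (λ i → shifts ds (λ y → h (y ℕ.+ i ℕ.* n)) x) (λ i → μ * h (x ℕ.+ i ℕ.* n)) ⟨
      ∑ r (λ i → shifts ds (λ y → h (y ℕ.+ i ℕ.* n)) x - μ * h (x ℕ.+ i ℕ.* n))
        ≡⟨ ∑-cong r (λ i → trans (cong (_- μ * h (x ℕ.+ i ℕ.* n)) (shifts-translate ds h (i ℕ.* n) x)) (Ah≡c (x ℕ.+ i ℕ.* n))) ⟩
      ∑ r (λ _ → c)
        ≡⟨ ∑-const r c ⟩
      + r * c ∎
      where open ≡-Reasoning

    ∑-A : ∀ {n h} → Periodic n h → ∑ n (A h) ≡ (+ length ds - μ) * ∑ n h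
    ∑-A {n} {h} per = begin
      ∑ n (A h)                                    ≡⟨ ∑-distrib-- n (shifts ds h) (λ x → μ * h x) ⟩
      ∑ n (shifts ds h) - ∑ n (λ x → μ * h x)      ≡⟨ cong₂ _-_ (∑-shifts ds per) (*-distribˡ-∑ n μ h) ⟩
      + length ds * ∑ n h - μ * ∑ n h              ≡⟨ factor (+ length ds) μ (∑ n h) ⟩
      (+ length ds - μ) * ∑ n h                    ∎
      where
      open ≡-Reasoning
      factor : ∀ a b c → a * c - b * c ≡ (a - b) * c
      factor = solve-∀

  module _ (n : ℕ) .{{_ : ℕ.NonZero n}} where
    open Correlation n

    -- d * pred n is -d modulo n
    kernel : List ℕ → ℤ → Sequence
    kernel []       μ y = - μ * 𝟙 n y
    kernel (d ∷ ds) μ y = 𝟙 n (y ℕ.+ d ℕ.* ℕ.pred n) + kernel ds μ y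

    kernel-periodic : ∀ ds μ → Periodic n (kernel ds μ)
    kernel-periodic []       μ x = cong (- μ *_) (𝟙-periodic n x)
    kernel-periodic (d ∷ ds) μ x = cong₂ _+_
      (trans (cong (𝟙 n) move) (𝟙-periodic n (x ℕ.+ d ℕ.* ℕ.pred n))) (kernel-periodic ds μ x)
      where
      move : x ℕ.+ n ℕ.+ d ℕ.* ℕ.pred n ≡ x ℕ.+ d ℕ.* ℕ.pred n ℕ.+ n
      move = trans (ℕₚ.+-assoc x n _) (trans (cong (x ℕ.+_) (ℕₚ.+-comm n _)) (sym (ℕₚ.+-assoc x _ n)))

    𝟙-⋆ : ∀ h → 𝟙 n ⋆ h ≗ h
    𝟙-⋆ h x = trans (∑-𝟙 n (λ y → h (x ℕ.+ y))) (cong h (ℕₚ.+-identityʳ x))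

    -- Correlation with a unit mass at the residue of `d` evaluates at `x + d`. The kernel has one
    -- such mass for each displacement and `- μ` at zero.
    kernel-⋆ : ∀ ds μ {h} → Periodic n h → kernel ds μ ⋆ h ≗ A ds μ h
    kernel-⋆ [] μ {h} per x = begin
      ∑ n (λ y → - μ * 𝟙 n y * h (x ℕ.+ y))      ≡⟨ ∑-cong n (λ y → ℤₚ.*-assoc (- μ) (𝟙 n y) (h (x ℕ.+ y))) ⟩
      ∑ n (λ y → - μ * (𝟙 n y * h (x ℕ.+ y)))    ≡⟨ *-distribˡ-∑ n (- μ) (λ y → 𝟙 n y * h (x ℕ.+ y)) ⟩
      - μ * (𝟙 n ⋆ h) x                          ≡⟨ cong (- μ *_) (𝟙-⋆ h x) ⟩
      - μ * h x                                  ≡⟨ simplify μ (h x) ⟩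
      0ℤ - μ * h x                               ∎
      where
      open ≡-Reasoning
      simplify : ∀ a b → - a * b ≡ 0ℤ - a * b
      simplify = solve-∀
    kernel-⋆ (d ∷ ds) μ {h} per x = begin
      ∑ n (λ y → (e y + kernel ds μ y) * h (x ℕ.+ y))
        ≡⟨ ∑-cong n (λ y → ℤₚ.*-distribʳ-+ (h (x ℕ.+ y)) (e y) (kernel ds μ y)) ⟩
      ∑ n (λ y → e y * h (x ℕ.+ y) + kernel ds μ y * h (x ℕ.+ y))
        ≡⟨ ∑-distrib-+ n (λ y → e y * h (x ℕ.+ y)) (λ y → kernel ds μ y * h (x ℕ.+ y)) ⟩
      (e ⋆ h) x + (kernel ds μ ⋆ h) x
        ≡⟨ cong₂ _+_ e-⋆ (kernel-⋆ ds μ per x) ⟩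
      h (x ℕ.+ d) + (shifts ds h x - μ * h x)
        ≡⟨ ℤₚ.+-assoc (h (x ℕ.+ d)) (shifts ds h x) (- (μ * h x)) ⟨
      h (x ℕ.+ d) + shifts ds h x - μ * h x ∎
      where
      open ≡-Reasoning
      e : Sequence
      e y = 𝟙 n (y ℕ.+ d ℕ.* ℕ.pred n)
      e-per : Periodic n e
      e-per y = trans (cong (𝟙 n) (trans (ℕₚ.+-assoc y n _) (trans (cong (y ℕ.+_) (ℕₚ.+-comm n _)) (sym (ℕₚ.+-assoc y _ n)))))
                      (𝟙-periodic n (y ℕ.+ d ℕ.* ℕ.pred n))
      e-shift : ∀ y → e (y ℕ.+ d) ≡ 𝟙 n y
      e-shift y = trans (cong (𝟙 n) (trans (ℕₚ.+-assoc y d _) (cong (y ℕ.+_)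
                    (trans (sym (ℕₚ.*-suc d (ℕ.pred n))) (cong (d ℕ.*_) (ℕₚ.suc-pred n))))))
                  (periodic-* d (𝟙-periodic n) y)
      e-⋆ : (e ⋆ h) x ≡ h (x ℕ.+ d)
      e-⋆ = begin
        (e ⋆ h) x                                          ≡⟨ ⋆-shift e-per per d x ⟨
        ∑ n (λ y → e (y ℕ.+ d) * h (x ℕ.+ d ℕ.+ y))        ≡⟨ ∑-cong n (λ y → cong (_* h (x ℕ.+ d ℕ.+ y)) (e-shift y)) ⟩
        (𝟙 n ⋆ h) (x ℕ.+ d)                                ≡⟨ 𝟙-⋆ h (x ℕ.+ d) ⟩
        h (x ℕ.+ d)                                        ∎

open import Data.List using (List)

-- Induction over the levels `q ^ j`.

module Levels {q : ℕ} (q-prime : Prime q) (ds : List ℕ) (μ : ℤ) where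
  open import Data.List using (length)
  open import Data.Integer
    using (ℤ; +_; 0ℤ; 1ℤ; _+_; _*_; -_; _-_; _≤_)
  open import Data.Integer.Properties as ℤₚ using ()
  open import Data.Integer.Divisibility.Signed using (_∣_; divides; ∣⇒∣ᵤ; *-monoʳ-∣)
  open import Data.Integer.Tactic.RingSolver using (solve-∀)
  open Averaging
  open ShiftOperators

  private instance _ = prime⇒nonZero q-prime

  -- The coefficient at 0 of the kernel of A modulo q ^ j.
  multiplicity : ℕ → ℤ
  multiplicity j = shifts ds (𝟙 (q ℕ.^ j)) 0 - μ

  A-𝟙 : ∀ j → A ds μ (𝟙 (q ℕ.^ j)) 0 ≡ multiplicity j
  A-𝟙 j = cong (λ a → shifts ds (𝟙 (q ℕ.^ j)) 0 - a)
               (trans (cong (μ *_) (𝟙-∣ ((q ℕ.^ j) ℕ∣.∣0))) (ℤₚ.*-identityʳ μ))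

  multiplicity-step : ∀ j → multiplicity (suc j) ≤ multiplicity j
  multiplicity-step j = ℤₚ.+-monoˡ-≤ (- μ)
    (shifts-mono-≤ ds (𝟙-mono-∣ (ℕ∣.n∣m*n q {q ℕ.^ j})) 0)

  -μ≤multiplicity : ∀ j → - μ ≤ multiplicity j
  -μ≤multiplicity j = subst (_≤ multiplicity j) (ℤₚ.+-identityˡ (- μ)) (ℤₚ.+-monoˡ-≤ (- μ)
    (subst (_≤ shifts ds (𝟙 (q ℕ.^ j)) 0) (trans (shifts-const ds 0ℤ 0) (ℤₚ.*-zeroʳ (+ length ds)))
      (shifts-mono-≤ ds (0≤𝟙 (q ℕ.^ j)) 0)))

  multiplicity-zero : multiplicity 0 ≡ + length ds - μ
  multiplicity-zero = cong (_- μ) (trans (shifts-cong ds (λ x → 𝟙-∣ (ℕ∣.1∣ x)) 0)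
    (trans (shifts-const ds 1ℤ 0) (ℤₚ.*-identityʳ (+ length ds))))

  module _ (j : ℕ) where
    open Cyclotomic q-prime j using (K; M; periodicᴹ; primality)
    open Correlation M
    private instance
      _ = ℕₚ.m^n≢0 q j
      _ = ℕₚ.m^n≢0 q (suc j)

    -- The kernel modulo `K` sums the kernel modulo `M` over residue classes, so `multiplicity j` is
    -- the sum of `q` values at multiples of `K`. Under period `K` all of them equal the value at 0,
    -- which is `multiplicity (suc j)`.
    q*multiplicity : Periodic K (kernel M ds μ) → + q * multiplicity (suc j) ≡ multiplicity j
    q*multiplicity p-per = begin
      + q * multiplicity (suc j)        ≡⟨ cong (+ q *_) (begin
        multiplicity (suc j)                ≡⟨ A-𝟙 (suc j) ⟨
        A ds μ (𝟙 M) 0                      ≡⟨ kernel-⋆ M ds μ (𝟙-periodic M) 0 ⟨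
        ∑ M (λ y → p y * 𝟙 M y)             ≡⟨ ∑-cong M (λ y → ℤₚ.*-comm (p y) (𝟙 M y)) ⟩
        ∑ M (λ y → 𝟙 M y * p y)             ≡⟨ ∑-𝟙 M p ⟩
        p 0                                 ≡⟨ ∑-𝟙 K p ⟨
        ∑ K (λ y → 𝟙 K y * p y)             ≡⟨ ∑-cong K (λ y → ℤₚ.*-comm (𝟙 K y) (p y)) ⟩
        ∑ K (λ y → p y * 𝟙 K y)             ∎) ⟩
      + q * ∑ K (λ y → p y * 𝟙 K y)     ≡⟨ ∑-periodic q (λ y → cong₂ _*_ (p-per y) (𝟙-periodic K y)) ⟨
      ∑ M (λ y → p y * 𝟙 K y)           ≡⟨ kernel-⋆ M ds μ (periodicᴹ (𝟙-periodic K)) 0 ⟩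
      A ds μ (𝟙 K) 0                    ≡⟨ A-𝟙 j ⟩
      multiplicity j                    ∎
      where
      open ≡-Reasoning
      p = kernel M ds μ

    -- A constant has period `K`, so the product of the kernel and `h` is zero in ℤ[ζ] and one of
    -- the factors is.
    dichotomy : ∀ {h c} → Periodic M h → (∀ x → A ds μ h x ≡ c) →
                (+ q * multiplicity (suc j) ≡ multiplicity j) ⊎ Periodic K h
    dichotomy {h} {c} h-per Ah≡c = Sum.map₁ q*multiplicity
      (primality {kernel M ds μ} {h} (kernel-periodic M ds μ) h-per (λ x → trans (⋆≡c (x ℕ.+ K)) (sym (⋆≡c x))))
      where
      ⋆≡c : ∀ x → (kernel M ds μ ⋆ h) x ≡ c
      ⋆≡c x = trans (kernel-⋆ M ds μ h-per x) (Ah≡c x)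

  -- Among the levels up to j, the operator A vanishes at t and h at i.
  Level : ℕ → Sequence → Set
  Level j h = ∃[ i ] ∃[ t ] i ℕ.+ t ≡ j × (+ (q ℕ.^ i) ∣ ∑ (q ℕ.^ j) h) × (multiplicity j * + (q ℕ.^ t) ≤ multiplicity 0)

  -- Averaging shortens the period and keeps the period sum, hence also `q ^ i`. The extra factor
  -- `q` in the inequality is the one lost by the multiplicity.
  level-average : ∀ j h → + q * multiplicity (suc j) ≡ multiplicity j →
                  Level j (average (q ℕ.^ j) q h) → Level (suc j) h
  level-average j h q*m≡m (i , t , i+t≡j , q^i∣∑ , m*q^t≤) =
    i , suc t , trans (ℕₚ.+-suc i t) (cong suc i+t≡j) ,
    subst (+ (q ℕ.^ i) ∣_) (∑-average (q ℕ.^ j) q h) q^i∣∑ ,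
    subst (_≤ multiplicity 0) (begin
      multiplicity j * + (q ℕ.^ t)               ≡⟨ cong (_* + (q ℕ.^ t)) q*m≡m ⟨
      + q * multiplicity (suc j) * + (q ℕ.^ t)   ≡⟨ cong (_* + (q ℕ.^ t)) (ℤₚ.*-comm (+ q) (multiplicity (suc j))) ⟩
      multiplicity (suc j) * + q * + (q ℕ.^ t)   ≡⟨ ℤₚ.*-assoc (multiplicity (suc j)) (+ q) (+ (q ℕ.^ t)) ⟩
      multiplicity (suc j) * (+ q * + (q ℕ.^ t)) ≡⟨ cong (multiplicity (suc j) *_) (ℤₚ.pos-* q (q ℕ.^ t)) ⟨
      multiplicity (suc j) * + (q ℕ.^ suc t)     ∎) m*q^t≤
    where open ≡-Reasoning

  -- The longer period contains `q` copies of the shorter one, so the sum gains a factor `q`; the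
  -- multiplicity cannot increase.
  level-periodic : ∀ j h → Periodic (q ℕ.^ j) h → Level j h → Level (suc j) h
  level-periodic j h h-per (i , t , i+t≡j , q^i∣∑ , m*q^t≤) =
    suc i , t , cong suc i+t≡j ,
    subst₂ _∣_ (sym (ℤₚ.pos-* q (q ℕ.^ i))) (sym (∑-periodic q h-per)) (*-monoʳ-∣ (+ q) q^i∣∑) ,
    ℤₚ.≤-trans (ℤₚ.*-monoʳ-≤-nonNeg (+ (q ℕ.^ t)) (multiplicity-step j)) m*q^t≤

  -- Where `A` vanishes nothing is learnt about `h`, and its average over `q` translates takes its
  -- place. This multiplies the right-hand side by `q`, so the induction is over all constants `c`.
  levels : ∀ j {h c} → Periodic (q ℕ.^ j) h → (∀ x → A ds μ h x ≡ c) → Level j h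
  levels zero {h} h-per Ah≡c = 0 , 0 , refl , divides (∑ 1 h) (sym (ℤₚ.*-identityʳ (∑ 1 h))) ,
    ℤₚ.≤-reflexive (ℤₚ.*-identityʳ (multiplicity 0))
  levels (suc j) {h} h-per Ah≡c =
    [ (λ q*m≡m → level-average j h q*m≡m
        (levels j (average-periodic (q ℕ.^ j) q h-per) (A-average ds μ (q ℕ.^ j) q {h} Ah≡c)))
    , (λ h-perᴷ → level-periodic j h h-perᴷ (levels j h-perᴷ Ah≡c))
    ]′ (dichotomy j {h} h-per Ah≡c)

  factor-power : ∀ n .{{_ : ℕ.NonZero n}} → ∃[ a ] ∃[ r ] n ≡ r ℕ.* q ℕ.^ a × ¬ q ℕ∣.∣ r
  factor-power = <-rec (λ n → .{{_ : ℕ.NonZero n}} → ∃[ a ] ∃[ r ] n ≡ r ℕ.* q ℕ.^ a × ¬ q ℕ∣.∣ r) go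
    where
    go : ∀ n → (∀ {m} → m ℕ.< n → .{{_ : ℕ.NonZero m}} → ∃[ a ] ∃[ r ] m ≡ r ℕ.* q ℕ.^ a × ¬ q ℕ∣.∣ r) →
         .{{_ : ℕ.NonZero n}} → ∃[ a ] ∃[ r ] n ≡ r ℕ.* q ℕ.^ a × ¬ q ℕ∣.∣ r
    go n rec with q ℕ∣.∣? n
    ... | no q∤n = 0 , n , sym (ℕₚ.*-identityʳ n) , q∤n
    ... | yes (ℕ∣.divides m@(suc _) refl)
      with a , r , m≡r*q^a , q∤r ← rec {m} (ℕₚ.m<m*n m q (ℕ.nonTrivial⇒n>1 q {{prime⇒nonTrivial q-prime}})) =
      suc a , r , trans (cong (ℕ._* q) m≡r*q^a) (trans (ℕₚ.*-assoc r (q ℕ.^ a) q) (cong (r ℕ.*_) (ℕₚ.*-comm (q ℕ.^ a) q))) , q∤r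

  -- Averaging over `r` translates leaves the period `q ^ a` and the right-hand side `r * c`. The
  -- factor `r` is cancelled at the end, being prime to `q`.
  bounds : ∀ s n .{{_ : ℕ.NonZero n}} {g c} → + length ds - μ ≡ + (q ℕ.^ s) →
           Periodic n g → (∀ x → A ds μ g x ≡ + c) →
           ∃[ t ] (q ℕ.^ s ℕ∣.∣ q ℕ.^ t ℕ.* c) × (- μ * + (q ℕ.^ t) ≤ + (q ℕ.^ s))
  bounds s n {g} {c} mass≡q^s g-per Ag≡c
    with a , r , refl , q∤r ← factor-power n
    with i , t , refl , divides z ∑≡z*q^i , m*q^t≤ ←
      levels a (average-periodic (q ℕ.^ a) r g-per) (A-average ds μ (q ℕ.^ a) r Ag≡c) =
    t , Binomial.q^j∣m*n⇒q^j∣n q-prime s q∤r (∣⇒∣ᵤ (divides z final)) ,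
    ℤₚ.≤-trans (ℤₚ.*-monoʳ-≤-nonNeg (+ (q ℕ.^ t)) (-μ≤multiplicity (i ℕ.+ t)))
      (subst (multiplicity (i ℕ.+ t) * + (q ℕ.^ t) ≤_) (trans multiplicity-zero mass≡q^s) m*q^t≤)
    where
    open ≡-Reasoning
    instance _ = ℕₚ.m^n≢0 q i
    h = average (q ℕ.^ (i ℕ.+ t)) r g
    rearrange₁ : ∀ a b c → a * (b * c) ≡ c * (b * a)
    rearrange₁ = solve-∀
    rearrange₂ : ∀ a b c d → a * b * (c * d) ≡ a * (c * (b * d))
    rearrange₂ = solve-∀
    -- The sum of `A h` over a period is computed twice: from the row sum `q ^ s` of `A` times the
    -- sum of `h`, and from the constant `r * c`.
    final : + (r ℕ.* (q ℕ.^ t ℕ.* c)) ≡ z * + (q ℕ.^ s)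
    final = ℤₚ.*-cancelˡ-≡ (+ (q ℕ.^ i)) _ _ (sym (begin
      + (q ℕ.^ i) * (z * + (q ℕ.^ s))                      ≡⟨ rearrange₁ (+ (q ℕ.^ i)) z (+ (q ℕ.^ s)) ⟩
      + (q ℕ.^ s) * (z * + (q ℕ.^ i))                      ≡⟨ cong₂ _*_ mass≡q^s ∑≡z*q^i ⟨
      (+ length ds - μ) * ∑ (q ℕ.^ (i ℕ.+ t)) h            ≡⟨ ∑-A ds μ (average-periodic (q ℕ.^ (i ℕ.+ t)) r g-per) ⟨
      ∑ (q ℕ.^ (i ℕ.+ t)) (A ds μ h)                       ≡⟨ ∑-cong (q ℕ.^ (i ℕ.+ t)) (A-average ds μ (q ℕ.^ (i ℕ.+ t)) r Ag≡c) ⟩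
      ∑ (q ℕ.^ (i ℕ.+ t)) (λ _ → + r * + c)                ≡⟨ ∑-const (q ℕ.^ (i ℕ.+ t)) (+ r * + c) ⟩
      + (q ℕ.^ (i ℕ.+ t)) * (+ r * + c)                    ≡⟨ cong (λ y → + y * (+ r * + c)) (ℕₚ.^-distribˡ-+-* q i t) ⟩
      + (q ℕ.^ i ℕ.* q ℕ.^ t) * (+ r * + c)                ≡⟨ cong (_* (+ r * + c)) (ℤₚ.pos-* (q ℕ.^ i) (q ℕ.^ t)) ⟩
      + (q ℕ.^ i) * + (q ℕ.^ t) * (+ r * + c)              ≡⟨ rearrange₂ (+ (q ℕ.^ i)) (+ (q ℕ.^ t)) (+ r) (+ c) ⟩
      + (q ℕ.^ i) * (+ r * (+ (q ℕ.^ t) * + c))            ≡⟨ cong (λ y → + (q ℕ.^ i) * (+ r * y)) (ℤₚ.pos-* (q ℕ.^ t) c) ⟨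
      + (q ℕ.^ i) * (+ r * + (q ℕ.^ t ℕ.* c))              ≡⟨ cong (+ (q ℕ.^ i) *_) (ℤₚ.pos-* r (q ℕ.^ t ℕ.* c)) ⟨
      + (q ℕ.^ i) * + (r ℕ.* (q ℕ.^ t ℕ.* c))              ∎))

-- A perfect colouring of a circulant graph is eventually periodic on ℕ: the
-- differences between it and a translate obey a linear recurrence.
module Recurrence where
  open import Data.Fin using (Fin; toℕ; fromℕ<; zero; suc; funToFin; finToFun)
  open import Data.Fin.Properties using (pigeonhole; finToFun-funToFin; toℕ-fromℕ<)
  open import Data.List using (List; []; _∷_; map)
  open import Data.List.Membership.Propositional using (_∈_)
  open import Data.List.Relation.Unary.All using (All; []; _∷_)
  open import Data.List.Relation.Unary.Any using (here; there)
  open import Data.Integer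
    using (ℤ; +_; 0ℤ; 1ℤ; _+_; _*_; _-_)
  open import Data.Integer.Properties as ℤₚ using ()
  open import Data.Integer.Tactic.RingSolver using (solve-∀)
  open ShiftOperators

  -- After `n` zeros only the displacements equal to `n` survive. Their number `m` is the leading
  -- coefficient of the recurrence, which need not be 1.
  shifts-top : ∀ ds n {u x} → All (ℕ._≤ n) ds → (∀ {d} → d ℕ.< n → u (x ℕ.+ d) ≡ 0ℤ) →
               ∃[ m ] (n ∈ ds → 0 ℕ.< m) × shifts ds u x ≡ + m * u (x ℕ.+ n)
  shifts-top [] n {u} {x} [] u≡0 = 0 , (λ ()) , sym (ℤₚ.*-zeroˡ (u (x ℕ.+ n)))
  shifts-top (d ∷ ds) n {u} {x} (d≤n ∷ ds≤n) u≡0 with shifts-top ds n {u} {x} ds≤n u≡0 | ℕₚ.m≤n⇒m<n∨m≡n d≤n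
  ... | m , n∈ds⇒0<m , eq | inj₁ d<n =
    m , (λ { (here refl) → contradiction d<n (ℕₚ.<-irrefl refl) ; (there n∈ds) → n∈ds⇒0<m n∈ds }) ,
    trans (cong (_+ shifts ds u x) (u≡0 d<n)) (trans (ℤₚ.+-identityˡ _) eq)
  ... | m , _ , eq | inj₂ refl =
    suc m , (λ _ → ℕ.z<s) , trans (cong (λ a → u (x ℕ.+ n) + a) eq) (sym (ℤₚ.suc-* (+ m) (u (x ℕ.+ n))))

  -- As `e` is below `n`, the right-hand side lies in the window of zeros, and the positive leading
  -- coefficient cancels in ℤ; the next value is zero too.
  shifts-zero : ∀ ds n μ {e u} → All (ℕ._≤ n) ds → n ∈ ds → e ℕ.< n →
                (∀ x → shifts ds u x ≡ μ * u (x ℕ.+ e)) →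
                ∀ i → (∀ {d} → d ℕ.< n → u (i ℕ.+ d) ≡ 0ℤ) → ∀ d → u (i ℕ.+ d) ≡ 0ℤ
  shifts-zero ds n μ {e} {u} ds≤n n∈ds e<n rec i init = <-rec _ go
    where
    go : ∀ d → (∀ {d′} → d′ ℕ.< d → u (i ℕ.+ d′) ≡ 0ℤ) → u (i ℕ.+ d) ≡ 0ℤ
    go d below with d ℕ.<? n
    ... | yes d<n = init d<n
    ... | no  d≮n = subst (λ y → u y ≡ 0ℤ) x+n≡i+d u[x+n]≡0
      where
      open ≡-Reasoning
      n≤d = ℕₚ.≮⇒≥ d≮n
      x = i ℕ.+ (d ℕ.∸ n)
      x+n≡i+d : x ℕ.+ n ≡ i ℕ.+ d
      x+n≡i+d = trans (ℕₚ.+-assoc i (d ℕ.∸ n) n) (cong (i ℕ.+_) (ℕₚ.m∸n+n≡m n≤d))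
      zeros : ∀ {d′} → d′ ℕ.< n → u (x ℕ.+ d′) ≡ 0ℤ
      zeros {d′} d′<n = subst (λ y → u y ≡ 0ℤ) (sym (ℕₚ.+-assoc i (d ℕ.∸ n) d′))
        (below (subst (d ℕ.∸ n ℕ.+ d′ ℕ.<_) (ℕₚ.m∸n+n≡m n≤d) (ℕₚ.+-monoʳ-< (d ℕ.∸ n) d′<n)))
      u[x+n]≡0 : u (x ℕ.+ n) ≡ 0ℤ
      u[x+n]≡0 with shifts-top ds n {u} {x} ds≤n zeros
      ... | zero  , 0<m , _  = contradiction (0<m n∈ds) λ ()
      ... | suc m , _   , eq = ℤₚ.*-cancelˡ-≡ (+ suc m) (u (x ℕ.+ n)) 0ℤ (begin
        + suc m * u (x ℕ.+ n)  ≡⟨ eq ⟨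
        shifts ds u x          ≡⟨ rec x ⟩
        μ * u (x ℕ.+ e)        ≡⟨ cong (μ *_) (zeros e<n) ⟩
        μ * 0ℤ                 ≡⟨ ℤₚ.*-zeroʳ μ ⟩
        0ℤ                     ≡⟨ ℤₚ.*-zeroʳ (+ suc m) ⟨
        + suc m * 0ℤ           ∎)

  shifts-distrib-- : ∀ ds u v x → shifts ds (λ y → u y - v y) x ≡ shifts ds u x - shifts ds v x
  shifts-distrib-- []       u v x = refl
  shifts-distrib-- (d ∷ ds) u v x = trans (cong (λ a → u (x ℕ.+ d) - v (x ℕ.+ d) + a) (shifts-distrib-- ds u v x))
    (regroup (u (x ℕ.+ d)) (v (x ℕ.+ d)) (shifts ds u x) (shifts ds v x))
    where
    regroup : ∀ a b c d → a - b + (c - d) ≡ a + c - (b + d)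
    regroup = solve-∀

  shifts-map-+ : ∀ ds m u x → shifts (map (m ℕ.+_) ds) u x ≡ shifts ds u (x ℕ.+ m)
  shifts-map-+ []       m u x = refl
  shifts-map-+ (d ∷ ds) m u x = cong₂ _+_ (cong u (sym (ℕₚ.+-assoc x m d))) (shifts-map-+ ds m u x)

  colourCode : Colour → Fin 2
  colourCode black = zero
  colourCode white = suc zero

  colourCode-injective : ∀ {x y} → colourCode x ≡ colourCode y → x ≡ y
  colourCode-injective {black} {black} _ = refl
  colourCode-injective {white} {white} _ = refl

  -- There are `2 ^ n` patterns of length `n`, numbered by `funToFin`, so two of the first
  -- `1 + 2 ^ n` windows agree.
  repeated-window : ∀ n (f : ℕ → Colour) → ∃[ i ] ∃[ p ] ℕ.NonZero p ×
                    (∀ {d} → d ℕ.< n → f (i ℕ.+ d ℕ.+ p) ≡ f (i ℕ.+ d))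
  repeated-window n f
    with i , j , i<j , eq ← pigeonhole (ℕₚ.n<1+n (2 ℕ.^ n)) (λ i → funToFin {n} (λ d → colourCode (f (toℕ i ℕ.+ toℕ d)))) =
    toℕ i , toℕ j ℕ.∸ toℕ i , ℕ.>-nonZero (ℕₚ.m<n⇒0<n∸m i<j) , λ {d} d<n → begin
      f (toℕ i ℕ.+ d ℕ.+ (toℕ j ℕ.∸ toℕ i))  ≡⟨ cong f (shuffle d (ℕₚ.<⇒≤ i<j)) ⟩
      f (toℕ j ℕ.+ d)                        ≡⟨ colourCode-injective (sym (codes-agree eq d<n)) ⟩
      f (toℕ i ℕ.+ d)                        ∎
    where
    open ≡-Reasoning
    shuffle : ∀ {i j} d → i ℕ.≤ j → i ℕ.+ d ℕ.+ (j ℕ.∸ i) ≡ j ℕ.+ d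
    shuffle {i} {j} d i≤j = begin
      i ℕ.+ d ℕ.+ (j ℕ.∸ i)    ≡⟨ cong (ℕ._+ (j ℕ.∸ i)) (ℕₚ.+-comm i d) ⟩
      d ℕ.+ i ℕ.+ (j ℕ.∸ i)    ≡⟨ ℕₚ.+-assoc d i (j ℕ.∸ i) ⟩
      d ℕ.+ (i ℕ.+ (j ℕ.∸ i))  ≡⟨ cong (d ℕ.+_) (ℕₚ.m+[n∸m]≡n i≤j) ⟩
      d ℕ.+ j                  ≡⟨ ℕₚ.+-comm d j ⟩
      j ℕ.+ d                  ∎
    window : Fin (suc (2 ℕ.^ n)) → Fin n → Fin 2
    window i d = colourCode (f (toℕ i ℕ.+ toℕ d))
    codes-agree : ∀ {i j d} → funToFin (window i) ≡ funToFin (window j) → d ℕ.< n →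
                  colourCode (f (toℕ i ℕ.+ d)) ≡ colourCode (f (toℕ j ℕ.+ d))
    codes-agree {i} {j} {d} eq d<n = begin
      colourCode (f (toℕ i ℕ.+ d))                    ≡⟨ cong (λ a → colourCode (f (toℕ i ℕ.+ a))) (toℕ-fromℕ< d<n) ⟨
      window i (fromℕ< d<n)                           ≡⟨ finToFun-funToFin (window i) (fromℕ< d<n) ⟨
      finToFun (funToFin (window i)) (fromℕ< d<n)     ≡⟨ cong (λ a → finToFun a (fromℕ< d<n)) eq ⟩
      finToFun (funToFin (window j)) (fromℕ< d<n)     ≡⟨ finToFun-funToFin (window j) (fromℕ< d<n) ⟩
      window j (fromℕ< d<n)                           ≡⟨ cong (λ a → colourCode (f (toℕ j ℕ.+ a))) (toℕ-fromℕ< d<n) ⟩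
      colourCode (f (toℕ j ℕ.+ d))                    ∎

  isBlack : Colour → ℤ
  isBlack black = 1ℤ
  isBlack white = 0ℤ

  periodic-solution : ∀ ds n μ c e (f : ℕ → Colour) → All (ℕ._≤ n) ds → n ∈ ds → e ℕ.< n →
    (∀ x → shifts ds (isBlack ∘ f) x ≡ c + μ * isBlack (f (x ℕ.+ e))) →
    ∃[ p ] ∃[ g ] ∃[ m ] ℕ.NonZero p × Periodic p g × (∀ x → A (map (m ℕ.+_) ds) μ g x ≡ c)
  periodic-solution ds n μ c e f ds≤n n∈ds e<n rec with repeated-window n f
  -- Raising every displacement by `p-1 * e` amounts to lowering it by `e` modulo `p`. This brings
  -- the central term of the recurrence from `x + e` back to `x` with displacements still in ℕ.
  ... | i , p@(suc p-1) , p≢0 , window = p , g , p-1 ℕ.* e , p≢0 , g-per , Ag≡c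
    where
    open ≡-Reasoning
    g₀ g δ : Sequence
    g₀ = isBlack ∘ f
    g x = g₀ (x ℕ.+ i)
    δ x = g₀ (x ℕ.+ p) - g₀ x
    cancel : ∀ a b c → a + b - (a + c) ≡ b - c
    cancel = solve-∀
    swap : ∀ x y z → x ℕ.+ y ℕ.+ z ≡ x ℕ.+ z ℕ.+ y
    swap x y z = trans (ℕₚ.+-assoc x y z) (trans (cong (x ℕ.+_) (ℕₚ.+-comm y z)) (sym (ℕₚ.+-assoc x z y)))
    factor : ∀ a b c → a * b - a * c ≡ a * (b - c)
    factor = solve-∀
    δ-rec : ∀ x → shifts ds δ x ≡ μ * δ (x ℕ.+ e)
    δ-rec x = begin
      shifts ds δ x                                               ≡⟨ shifts-distrib-- ds (λ y → g₀ (y ℕ.+ p)) g₀ x ⟩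
      shifts ds (λ y → g₀ (y ℕ.+ p)) x - shifts ds g₀ x           ≡⟨ cong (_- shifts ds g₀ x) (shifts-translate ds g₀ p x) ⟩
      shifts ds g₀ (x ℕ.+ p) - shifts ds g₀ x                     ≡⟨ cong₂ _-_ (rec (x ℕ.+ p)) (rec x) ⟩
      c + μ * g₀ (x ℕ.+ p ℕ.+ e) - (c + μ * g₀ (x ℕ.+ e))         ≡⟨ cancel c (μ * g₀ (x ℕ.+ p ℕ.+ e)) (μ * g₀ (x ℕ.+ e)) ⟩
      μ * g₀ (x ℕ.+ p ℕ.+ e) - μ * g₀ (x ℕ.+ e)                   ≡⟨ factor μ _ _ ⟩
      μ * (g₀ (x ℕ.+ p ℕ.+ e) - g₀ (x ℕ.+ e))                     ≡⟨ cong (λ y → μ * (g₀ y - g₀ (x ℕ.+ e))) (swap x p e) ⟩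
      μ * δ (x ℕ.+ e)                                             ∎
    δ≡0 : ∀ d → δ (i ℕ.+ d) ≡ 0ℤ
    δ≡0 = shifts-zero ds n μ {e} {δ} ds≤n n∈ds e<n δ-rec i (λ d<n → ℤₚ.i≡j⇒i-j≡0 (cong isBlack (window d<n)))
    g-per : Periodic p g
    g-per x = begin
      g₀ (x ℕ.+ p ℕ.+ i)     ≡⟨ cong g₀ (trans (swap x p i) (cong (ℕ._+ p) (ℕₚ.+-comm x i))) ⟩
      g₀ (i ℕ.+ x ℕ.+ p)     ≡⟨ ℤₚ.i-j≡0⇒i≡j (g₀ (i ℕ.+ x ℕ.+ p)) (g₀ (i ℕ.+ x)) (δ≡0 x) ⟩
      g₀ (i ℕ.+ x)           ≡⟨ cong g₀ (ℕₚ.+-comm i x) ⟩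
      g₀ (x ℕ.+ i)           ∎
    addˡ : ∀ a b → a + b - b ≡ a
    addˡ = solve-∀
    Ag≡c : ∀ x → A (map (p-1 ℕ.* e ℕ.+_) ds) μ g x ≡ c
    Ag≡c x = begin
      shifts (map (p-1 ℕ.* e ℕ.+_) ds) g x - μ * g x       ≡⟨ cong (_- μ * g x) (begin
        shifts (map (p-1 ℕ.* e ℕ.+_) ds) g x                   ≡⟨ shifts-map-+ ds (p-1 ℕ.* e) g x ⟩
        shifts ds g (x ℕ.+ p-1 ℕ.* e)                          ≡⟨ shifts-translate ds g₀ i (x ℕ.+ p-1 ℕ.* e) ⟩
        shifts ds g₀ (x ℕ.+ p-1 ℕ.* e ℕ.+ i)                   ≡⟨ rec (x ℕ.+ p-1 ℕ.* e ℕ.+ i) ⟩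
        c + μ * g₀ (x ℕ.+ p-1 ℕ.* e ℕ.+ i ℕ.+ e)               ≡⟨ cong (λ y → c + μ * g₀ y) (swap (x ℕ.+ p-1 ℕ.* e) i e) ⟩
        c + μ * g (x ℕ.+ p-1 ℕ.* e ℕ.+ e)                      ≡⟨ cong (λ y → c + μ * g y) (begin
          x ℕ.+ p-1 ℕ.* e ℕ.+ e                                    ≡⟨ ℕₚ.+-assoc x (p-1 ℕ.* e) e ⟩
          x ℕ.+ (p-1 ℕ.* e ℕ.+ e)                                  ≡⟨ cong (x ℕ.+_) (ℕₚ.+-comm (p-1 ℕ.* e) e) ⟩
          x ℕ.+ p ℕ.* e                                            ≡⟨ cong (x ℕ.+_) (ℕₚ.*-comm p e) ⟩
          x ℕ.+ e ℕ.* p                                            ∎) ⟩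
        c + μ * g (x ℕ.+ e ℕ.* p)                              ≡⟨ cong (λ y → c + μ * y) (periodic-* e g-per x) ⟩
        c + μ * g x                                            ∎) ⟩
      c + μ * g x - μ * g x                                ≡⟨ addˡ c (μ * g x) ⟩
      c                                                    ∎

-- Necessity: from a perfect colouring to the inequality.

module Necessity where
  open import Data.List using (List; []; _∷_; length; map)
  open import Data.List.Membership.Propositional using () renaming (_∈_ to _∈ˡ_)
  open import Data.List.Properties using (length-map)
  open import Data.List.Relation.Unary.All using (All; []; _∷_)
  open import Data.Nat.GCD using (gcd; gcd-greatest; c*gcd[m,n]≡gcd[cm,cn]; gcd[m,n]≡0⇒n≡0)
  open import Data.Vec using (count)
  open import Data.Integer
    using (ℤ; +_; 0ℤ; 1ℤ; _+_; _*_; -_; _-_; _⊖_; _≤_; +≤+; +<+; drop‿+≤+; positive)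
  open import Data.Integer.Properties as ℤₚ using ()
  open import Data.Integer.Tactic.RingSolver using (solve-∀)
  open ShiftOperators
  open Recurrence

  neighbourSum : ∀ {k} → Vec ℕ k → (ℤ → ℤ) → ℤ → ℤ
  neighbourSum []       G v = 0ℤ
  neighbourSum (l ∷ ls) G v = G (v + + l) + (G (v - + l) + neighbourSum ls G v)

  #black≡neighbourSum : ∀ {k} (ls : Vec ℕ k) f v → + #neighbours (C∞ ls) f black v ≡ neighbourSum ls (isBlack ∘ f) v
  #black≡neighbourSum []       f v = refl
  #black≡neighbourSum (l ∷ ls) f v with f (v + + l) | f (v - + l) | #black≡neighbourSum ls f v
  ... | black | black | eq = cong (λ a → 1ℤ + (1ℤ + a)) eq
  ... | black | white | eq = cong (λ a → 1ℤ + a) (trans eq (sym (ℤₚ.+-identityˡ _)))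
  ... | white | black | eq = trans (cong (λ a → 1ℤ + a) eq) (sym (ℤₚ.+-identityˡ _))
  ... | white | white | eq = trans eq (sym (trans (ℤₚ.+-identityˡ _) (ℤₚ.+-identityˡ _)))

  count-black+white : ∀ {n} {V : Set} (f : V → Colour) (vs : Vec V n) →
    count (λ u → f u ≟ᶜ black) vs ℕ.+ count (λ u → f u ≟ᶜ white) vs ≡ n
  count-black+white f []       = refl
  count-black+white f (v ∷ vs) with f v
  ... | black = cong suc (count-black+white f vs)
  ... | white = trans (ℕₚ.+-suc _ _) (cong suc (count-black+white f vs))

  module _ {k b c : ℕ} (ls : Vec ℕ k) {f : ℤ → Colour} (perfect : IsPerfectColouring (C∞ ls) b c f) where
    open IsPerfectColouring perfect

    μ : ℤ
    μ = + (k ℕ.* 2) - + (b ℕ.+ c)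

    -- A black vertex has `2k - b` black neighbours, which is `c + μ`, so one affine formula serves
    -- both colours.
    neighbourSum-perfect : ∀ v → neighbourSum ls (isBlack ∘ f) v ≡ + c + μ * isBlack (f v)
    neighbourSum-perfect v with f v in eq
    ... | white = begin
      neighbourSum ls (isBlack ∘ f) v    ≡⟨ #black≡neighbourSum ls f v ⟨
      + #neighbours (C∞ ls) f black v    ≡⟨ cong +_ (white-vertex v eq) ⟩
      + c                                ≡⟨ ℤₚ.+-identityʳ (+ c) ⟨
      + c + 0ℤ                           ≡⟨ cong (λ a → + c + a) (ℤₚ.*-zeroʳ μ) ⟨
      + c + μ * 0ℤ                       ∎
      where open ≡-Reasoning
    ... | black = begin
      neighbourSum ls (isBlack ∘ f) v    ≡⟨ #black≡neighbourSum ls f v ⟨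
      + #b                               ≡⟨ add (+ #b) (+ b) (+ c) ⟩
      + c + (+ #b + + b - (+ b + + c))   ≡⟨ cong (λ a → + c + (a - + (b ℕ.+ c))) (cong +_ (trans (cong (#b ℕ.+_) (sym (black-vertex v eq))) (count-black+white f (circulantNeighbours ls v)))) ⟩
      + c + μ                            ≡⟨ cong (λ a → + c + a) (ℤₚ.*-identityʳ μ) ⟨
      + c + μ * 1ℤ                       ∎
      where
      open ≡-Reasoning
      #b = #neighbours (C∞ ls) f black v
      add : ∀ a b c → a ≡ c + (a + b - (b + c))
      add = solve-∀

  -- The displacements `l` and `-l` seen from `L` below the vertex. With `L` at least every
  -- distance, the truncated subtraction is exact.
  offsets : ∀ {k} → ℕ → Vec ℕ k → List ℕ
  offsets L []       = []
  offsets L (l ∷ ls) = L ℕ.+ l ∷ L ℕ.∸ l ∷ offsets L ls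

  length-offsets : ∀ {k} L (ls : Vec ℕ k) → length (offsets L ls) ≡ k ℕ.* 2
  length-offsets L []       = refl
  length-offsets L (l ∷ ls) = cong (λ n → suc (suc n)) (length-offsets L ls)

  open import Data.Vec.Relation.Unary.All as Vec using ([]; _∷_)
  open import Data.Vec.Membership.Propositional using (_∈_)
  open import Data.Vec.Relation.Unary.Any using (here; there)
  import Data.List.Relation.Unary.Any as Anyˡ

  offsets-≤ : ∀ {k} L {ls : Vec ℕ k} → Vec.All (ℕ._≤ L) ls → All (ℕ._≤ L ℕ.+ L) (offsets L ls)
  offsets-≤ L []             = []
  offsets-≤ L {l ∷ _} (l≤L ∷ ls≤L) = ℕₚ.+-monoʳ-≤ L l≤L ∷ ℕₚ.≤-trans (ℕₚ.m∸n≤m L l) (ℕₚ.m≤m+n L L) ∷ offsets-≤ L ls≤L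

  L+L∈offsets : ∀ {k} L {ls : Vec ℕ k} → L ∈ ls → L ℕ.+ L ∈ˡ offsets L ls
  L+L∈offsets L (here refl) = Anyˡ.here refl
  L+L∈offsets L (there L∈ls) = Anyˡ.there (Anyˡ.there (L+L∈offsets L L∈ls))

  shifts-offsets : ∀ {k} L {ls : Vec ℕ k} G x → Vec.All (ℕ._≤ L) ls →
                   shifts (offsets L ls) (G ∘ +_) x ≡ neighbourSum ls G (+ (x ℕ.+ L))
  shifts-offsets L G x [] = refl
  shifts-offsets L {l ∷ ls} G x (l≤L ∷ ls≤L) = cong₂ (λ a b → a + b) (cong (G ∘ +_) (sym (ℕₚ.+-assoc x L l)))
    (cong₂ _+_ (cong G below) (shifts-offsets L G x ls≤L))
    where
    below : + (x ℕ.+ (L ℕ.∸ l)) ≡ + (x ℕ.+ L) - + l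
    below = begin
      + (x ℕ.+ (L ℕ.∸ l))       ≡⟨ cong +_ (ℕₚ.+-∸-assoc x l≤L) ⟨
      + (x ℕ.+ L ℕ.∸ l)         ≡⟨ ℤₚ.⊖-≥ (ℕₚ.≤-trans l≤L (ℕₚ.m≤n+m L x)) ⟨
      (x ℕ.+ L) ⊖ l ≡⟨ ℤₚ.m-n≡m⊖n (x ℕ.+ L) l ⟨
      + (x ℕ.+ L) - + l         ∎
      where open ≡-Reasoning

  -- A positive maximum `L` puts the centre `L` strictly below the top displacement `L + L`, as the
  -- recurrence needs. When all distances are zero there are only loops, which positive `b` and `c`
  -- exclude directly.
  maximum : ∀ {k} (ls : Vec ℕ k) → Vec.All (_≡ 0) ls ⊎ ∃[ L ] 0 ℕ.< L × L ∈ ls × Vec.All (ℕ._≤ L) ls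
  maximum [] = inj₁ []
  maximum (l ∷ ls) with maximum ls
  maximum (zero  ∷ ls) | inj₁ ls≡0 = inj₁ (refl ∷ ls≡0)
  maximum (suc l ∷ ls) | inj₁ ls≡0 = inj₂ (suc l , ℕ.z<s , here refl , ℕₚ.≤-refl ∷ Vec.map (λ { refl → ℕ.z≤n }) ls≡0)
  maximum (l     ∷ ls) | inj₂ (L , 0<L , L∈ls , ls≤L) with ℕₚ.≤-total l L
  ... | inj₁ l≤L = inj₂ (L , 0<L , there L∈ls , l≤L ∷ ls≤L)
  ... | inj₂ L≤l = inj₂ (l , ℕₚ.<-≤-trans 0<L L≤l , here refl , ℕₚ.≤-refl ∷ Vec.map (λ x≤L → ℕₚ.≤-trans x≤L L≤l) ls≤L)

  -- Loops lead to no vertex of the other colour. This also makes zero distances harmless padding.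
  own-colour : ∀ {k} {ls : Vec ℕ k} → Vec.All (_≡ 0) ls → ∀ f {x} v → f v ≢ x → #neighbours (C∞ ls) f x v ≡ 0
  own-colour [] f v fv≢x = refl
  own-colour {ls = _ ∷ ls} (refl ∷ ls≡0) f {x} v fv≢x
    rewrite ℤₚ.+-identityʳ v with f v ≟ᶜ x
  ... | yes fv≡x = contradiction fv≡x fv≢x
  ... | no  _    = own-colour ls≡0 f v fv≢x

  -- Since `n` divides `t * (b + c)` and `t * c`, it divides `t * b`, hence `t * gcd b c`. So
  -- `(n - 2k) * t` is at most `gcd b c * t`, and the positive `t` cancels.
  bound : ∀ {k b c t n} → b ℕ.+ c ≡ n → n ℕ∣.∣ t ℕ.* c →
          .{{_ : ℕ.NonZero t}} → ℕ.NonZero (gcd b c) → - (+ (k ℕ.* 2) - + (b ℕ.+ c)) * + t ≤ + n →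
          b ℕ.+ c ℕ.≤ 2 ℕ.* k ℕ.+ gcd b c
  bound {k} {b} {c} {t} refl n∣t*c gcd≢0 small = drop‿+≤+ (subst₂ _≤_ (lhs (+ (k ℕ.* 2)) (+ (b ℕ.+ c))) rhs
    (ℤₚ.+-monoʳ-≤ (+ (k ℕ.* 2)) (ℤₚ.*-cancelʳ-≤-pos (- (+ (k ℕ.* 2) - + (b ℕ.+ c))) (+ gcd b c) (+ t) {{positive (+<+ (ℕ.>-nonZero⁻¹ t))}} (ℤₚ.≤-trans small n≤gcd*t))))
    where
    instance _ = gcd≢0
    lhs : ∀ a n → a + - (a - n) ≡ n
    lhs = solve-∀
    rhs : + (k ℕ.* 2 ℕ.+ gcd b c) ≡ + (2 ℕ.* k ℕ.+ gcd b c)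
    rhs = cong (λ a → + (a ℕ.+ gcd b c)) (ℕₚ.*-comm k 2)
    n∣t*b : b ℕ.+ c ℕ∣.∣ t ℕ.* b
    n∣t*b = ℕ∣.∣m+n∣m⇒∣n (subst (b ℕ.+ c ℕ∣.∣_) (trans (ℕₚ.*-distribˡ-+ t b c) (ℕₚ.+-comm (t ℕ.* b) (t ℕ.* c))) (ℕ∣.n∣m*n t)) n∣t*c
    n≤gcd*t : + (b ℕ.+ c) ≤ + gcd b c * + t
    n≤gcd*t = subst (+ (b ℕ.+ c) ≤_) (trans (cong +_ (ℕₚ.*-comm t (gcd b c))) (ℤₚ.pos-* (gcd b c) t))
      (+≤+ (ℕ∣.∣⇒≤ {{ℕₚ.m*n≢0 t (gcd b c)}}
        (subst (b ℕ.+ c ℕ∣.∣_) (sym (c*gcd[m,n]≡gcd[cm,cn] t b c)) (gcd-greatest n∣t*b n∣t*c))))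

  mass : ∀ {k b c} (ls : Vec ℕ k) {f} (perfect : IsPerfectColouring (C∞ ls) b c f) m L →
         + length (map (m ℕ.+_) (offsets L ls)) - μ ls perfect ≡ + (b ℕ.+ c)
  mass {k} {b} {c} ls perfect m L = trans
    (cong (λ a → + a - μ ls perfect) (trans (length-map (m ℕ.+_) (offsets L ls)) (length-offsets L ls)))
    (cancel (+ (k ℕ.* 2)) (+ (b ℕ.+ c)))
    where
    cancel : ∀ a b → a - (a - b) ≡ b
    cancel = solve-∀

  necessity : ∀ {k b c q} s → 0 ℕ.< b → 0 ℕ.< c → Prime q → b ℕ.+ c ≡ q ℕ.^ s →
              ∀ (ls : Vec ℕ k) {f} → IsPerfectColouring (C∞ ls) b c f → b ℕ.+ c ℕ.≤ 2 ℕ.* k ℕ.+ gcd b c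
  necessity {k} {b} {c} {q} s 0<b 0<c q-prime b+c≡q^s ls {f} perfect with maximum ls
  ... | inj₁ ls≡0 with f 0ℤ in eq
  ...   | black = contradiction (trans (sym (own-colour ls≡0 f 0ℤ (λ fv≡w → contradiction (trans (sym eq) fv≡w) λ ())))
                    (IsPerfectColouring.black-vertex perfect 0ℤ eq)) (ℕₚ.<⇒≢ 0<b)
  ...   | white = contradiction (trans (sym (own-colour ls≡0 f 0ℤ (λ fv≡b → contradiction (trans (sym eq) fv≡b) λ ())))
                    (IsPerfectColouring.white-vertex perfect 0ℤ eq)) (ℕₚ.<⇒≢ 0<c)
  necessity {k} {b} {c} {q} s 0<b 0<c q-prime b+c≡q^s ls {f} perfect
    | inj₂ (L , 0<L , L∈ls , ls≤L)
    with p , g , m , p≢0 , g-per , Ag≡c ←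
      periodic-solution (offsets L ls) (L ℕ.+ L) (μ ls perfect) (+ c) L (f ∘ +_)
        (offsets-≤ L ls≤L) (L+L∈offsets L L∈ls) (ℕₚ.m<m+n L 0<L)
        (λ x → trans (shifts-offsets L (isBlack ∘ f) x ls≤L) (neighbourSum-perfect ls perfect (+ (x ℕ.+ L))))
    with t , q^s∣q^t*c , small ←
      Levels.bounds q-prime (map (m ℕ.+_) (offsets L ls)) (μ ls perfect) s p {{p≢0}} {g} {c} (trans (mass ls perfect m L) (cong +_ b+c≡q^s)) g-per Ag≡c =
    bound {k} {b} {c} b+c≡q^s q^s∣q^t*c {{ℕₚ.m^n≢0 q t}} (ℕ.≢-nonZero (λ gcd≡0 → ℕₚ.<⇒≢ 0<c (sym (gcd[m,n]≡0⇒n≡0 b gcd≡0)))) small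
    where
    instance _ = prime⇒nonZero q-prime

-- Sufficiency: explicit distances and colourings.

module Construction where
  open import Data.Bool using (true; false; if_then_else_)
  open import Data.Nat.GCD using (gcd; gcd[m,n]∣m; gcd[m,n]∣n)
  open import Data.Vec using (_++_; replicate)
  import Data.Vec.Relation.Unary.All as Vec
  open import Relation.Nullary.Decidable using (dec-true; dec-false)
  open import Data.Integer
    using (ℤ; +_; -[1+_]; 0ℤ; 1ℤ; _+_; _*_; _-_; ∣_∣)
  open import Data.Integer.DivMod using (_%ℕ_; _/ℕ_; n%ℕd<d; a≡a%ℕn+[a/ℕn]*n)
  open import Data.Integer.Divisibility.Signed using (divides)
  open import Data.Integer.Properties as ℤₚ using ()
  open import Data.Integer.Tactic.RingSolver using (solve-∀)
  open ≡-Reasoning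
  open PeriodicSequences using (∣∧small⇒≡0)
  open Necessity using (own-colour)

  occurs : (ℤ → Colour) → Colour → ℤ → ℕ
  occurs f x u = if does (f u ≟ᶜ x) then 1 else 0

  occurs-≢ : ∀ f x {u} → f u ≢ x → occurs f x u ≡ 0
  occurs-≢ f x {u} fu≢x with f u ≟ᶜ x
  ... | yes fu≡x = contradiction fu≡x fu≢x
  ... | no  _    = refl

  #neighbours-∷ : ∀ {k} l (ls : Vec ℕ k) f x v → #neighbours (C∞ (l ∷ ls)) f x v ≡
    occurs f x (v + + l) ℕ.+ (occurs f x (v - + l) ℕ.+ #neighbours (C∞ ls) f x v)
  #neighbours-∷ l ls f x v with does (f (v + + l) ≟ᶜ x) | does (f (v - + l) ≟ᶜ x)
  ... | true  | true  = refl
  ... | true  | false = refl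
  ... | false | true  = refl
  ... | false | false = refl

  #neighbours-++ : ∀ {k k′} (ls : Vec ℕ k) (ls′ : Vec ℕ k′) f x v →
    #neighbours (C∞ (ls ++ ls′)) f x v ≡ #neighbours (C∞ ls) f x v ℕ.+ #neighbours (C∞ ls′) f x v
  #neighbours-++ []       ls′ f x v = refl
  #neighbours-++ (l ∷ ls) ls′ f x v = begin
    #neighbours (C∞ (l ∷ ls ++ ls′)) f x v                           ≡⟨ #neighbours-∷ l (ls ++ ls′) f x v ⟩
    a ℕ.+ (b ℕ.+ #neighbours (C∞ (ls ++ ls′)) f x v)                 ≡⟨ cong (λ y → a ℕ.+ (b ℕ.+ y)) (#neighbours-++ ls ls′ f x v) ⟩
    a ℕ.+ (b ℕ.+ (#neighbours (C∞ ls) f x v ℕ.+ #′))                 ≡⟨ cong (a ℕ.+_) (ℕₚ.+-assoc b _ #′) ⟨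
    a ℕ.+ (b ℕ.+ #neighbours (C∞ ls) f x v ℕ.+ #′)                   ≡⟨ ℕₚ.+-assoc a _ #′ ⟨
    a ℕ.+ (b ℕ.+ #neighbours (C∞ ls) f x v) ℕ.+ #′                   ≡⟨ cong (ℕ._+ #′) (#neighbours-∷ l ls f x v) ⟨
    #neighbours (C∞ (l ∷ ls)) f x v ℕ.+ #′                           ∎
    where
    a = occurs f x (v + + l)
    b = occurs f x (v - + l)
    #′ = #neighbours (C∞ ls′) f x v

  -- The parameters (b , c) are C white and C black.
  Perfect : (ℤ → Colour) → ℕ → (Colour → ℕ) → Set
  Perfect f k C = Σ[ ls ∈ Vec ℕ k ] (∀ x v → f v ≢ x → #neighbours (C∞ ls) f x v ≡ C x)

  perfect-0 : ∀ f k → Perfect f k (λ _ → 0)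
  perfect-0 f k = replicate k 0 , λ x → own-colour (replicate-0 k) f
    where
    replicate-0 : ∀ k → Vec.All (_≡ 0) (replicate k 0)
    replicate-0 zero    = Vec.[]
    replicate-0 (suc k) = refl Vec.∷ replicate-0 k

  -- For a fixed colouring, the numbers of neighbours of the other colour add when lists of
  -- distances are joined.
  perfect-+ : ∀ {f k k′ C C′} → Perfect f k C → Perfect f k′ C′ → Perfect f (k ℕ.+ k′) (λ x → C x ℕ.+ C′ x)
  perfect-+ {f} (ls , p) (ls′ , p′) = ls ++ ls′ , λ x v fv≢x →
    trans (#neighbours-++ ls ls′ f x v) (cong₂ ℕ._+_ (p x v fv≢x) (p′ x v fv≢x))

  perfect-* : ∀ d {f k C} → Perfect f k C → Perfect f (d ℕ.* k) (λ x → d ℕ.* C x)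
  perfect-* zero    {f} p = perfect-0 f 0
  perfect-* (suc d)     p = perfect-+ p (perfect-* d p)

  perfect-cong : ∀ {f k k′ C C′} → k ≡ k′ → (∀ x → C x ≡ C′ x) → Perfect f k C → Perfect f k′ C′
  perfect-cong refl C≗C′ (ls , p) = ls , λ x v fv≢x → trans (p x v fv≢x) (C≗C′ x)

  perfect-pad : ∀ {f k k′ C} → k ℕ.≤ k′ → Perfect f k C → Perfect f k′ C
  perfect-pad {f} {k} {k′} {C} k≤k′ p =
    perfect-cong (ℕₚ.m+[n∸m]≡n k≤k′) (λ x → ℕₚ.+-identityʳ (C x)) (perfect-+ p (perfect-0 f (k′ ℕ.∸ k)))

  window : ℤ → ℕ → (ℤ → ℕ) → ℤ → ℕ
  window σ zero    F v = 0
  window σ (suc n) F v = F v ℕ.+ window σ n F (v + σ)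

  window-+ : ∀ σ m n F v → window σ (m ℕ.+ n) F v ≡ window σ m F v ℕ.+ window σ n F (v + + m * σ)
  window-+ σ zero    n F v = cong (window σ n F) (origin v σ)
    where
    origin : ∀ v σ → v ≡ v + 0ℤ * σ
    origin = solve-∀
  window-+ σ (suc m) n F v = begin
    F v ℕ.+ window σ (m ℕ.+ n) F (v + σ)                                       ≡⟨ cong (F v ℕ.+_) (window-+ σ m n F (v + σ)) ⟩
    F v ℕ.+ (window σ m F (v + σ) ℕ.+ window σ n F (v + σ + + m * σ))          ≡⟨ ℕₚ.+-assoc (F v) _ _ ⟨
    F v ℕ.+ window σ m F (v + σ) ℕ.+ window σ n F (v + σ + + m * σ)            ≡⟨ cong (λ y → F v ℕ.+ window σ m F (v + σ) ℕ.+ window σ n F y) (move v σ (+ m)) ⟩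
    F v ℕ.+ window σ m F (v + σ) ℕ.+ window σ n F (v + + suc m * σ)            ∎
    where
    move : ∀ v σ m → v + σ + m * σ ≡ v + (1ℤ + m) * σ
    move = solve-∀

  window-∷ʳ : ∀ σ n F v → window σ (suc n) F v ≡ window σ n F v ℕ.+ F (v + + n * σ)
  window-∷ʳ σ n F v = begin
    window σ (suc n) F v                                ≡⟨ cong (λ m → window σ m F v) (ℕₚ.+-comm 1 n) ⟩
    window σ (n ℕ.+ 1) F v                              ≡⟨ window-+ σ n 1 F v ⟩
    window σ n F v ℕ.+ (F (v + + n * σ) ℕ.+ 0)          ≡⟨ cong (window σ n F v ℕ.+_) (ℕₚ.+-identityʳ _) ⟩
    window σ n F v ℕ.+ F (v + + n * σ)                  ∎

  window-const : ∀ n {F v} a → (∀ {i} → i ℕ.< n → F (v + + i) ≡ a) → window 1ℤ n F v ≡ n ℕ.* a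
  window-const zero        a F≡a = refl
  window-const (suc n) {F} {v} a F≡a = cong₂ ℕ._+_
    (trans (cong F (sym (ℤₚ.+-identityʳ v))) (F≡a ℕ.z<s))
    (window-const n a (λ {i} i<n → trans (cong F (ℤₚ.+-assoc v 1ℤ (+ i))) (F≡a (ℕ.s<s i<n))))

  module _ {n : ℕ} {F : ℤ → ℕ} (F-per : ∀ v → F (v + + n) ≡ F v) where

    window-suc : ∀ v → window 1ℤ n F (v + 1ℤ) ≡ window 1ℤ n F v
    window-suc v = ℕₚ.+-cancelˡ-≡ (F v) _ _ (begin
      F v ℕ.+ window 1ℤ n F (v + 1ℤ)           ≡⟨ window-∷ʳ 1ℤ n F v ⟩
      window 1ℤ n F v ℕ.+ F (v + + n * 1ℤ)     ≡⟨ cong (λ y → window 1ℤ n F v ℕ.+ F (v + y)) (ℤₚ.*-identityʳ (+ n)) ⟩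
      window 1ℤ n F v ℕ.+ F (v + + n)          ≡⟨ cong (window 1ℤ n F v ℕ.+_) (F-per v) ⟩
      window 1ℤ n F v ℕ.+ F v                  ≡⟨ ℕₚ.+-comm _ (F v) ⟩
      F v ℕ.+ window 1ℤ n F v                  ∎)

    window-translate : ∀ v → window 1ℤ n F v ≡ window 1ℤ n F 0ℤ
    window-translate (+ zero)      = refl
    window-translate (+ suc m)     = begin
      window 1ℤ n F (+ suc m)      ≡⟨ cong (λ y → window 1ℤ n F (+ y)) (ℕₚ.+-comm 1 m) ⟩
      window 1ℤ n F (+ m + 1ℤ)     ≡⟨ window-suc (+ m) ⟩
      window 1ℤ n F (+ m)          ≡⟨ window-translate (+ m) ⟩
      window 1ℤ n F 0ℤ             ∎
    window-translate -[1+ zero ]   = sym (window-suc -[1+ 0 ])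
    window-translate -[1+ suc m ]  = trans (sym (window-suc -[1+ suc m ])) (window-translate -[1+ m ])

  interval : ∀ h → Vec ℕ h
  interval zero    = []
  interval (suc h) = suc h ∷ interval h

  -- Together with `v` itself, the neighbours fill the integers from `v - h` to `v + h` without
  -- gaps.
  #neighbours-interval : ∀ h f x v → occurs f x v ℕ.+ #neighbours (C∞ (interval h)) f x v
                                     ≡ window 1ℤ (suc (h ℕ.+ h)) (occurs f x) (v - + h)
  #neighbours-interval zero    f x v = cong (λ y → occurs f x y ℕ.+ 0) (sym (ℤₚ.+-identityʳ v))
  #neighbours-interval (suc h) f x v = begin
    F v ℕ.+ #neighbours (C∞ (interval (suc h))) f x v
      ≡⟨ cong (F v ℕ.+_) (#neighbours-∷ (suc h) (interval h) f x v) ⟩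
    F v ℕ.+ (F (v + + suc h) ℕ.+ (F (v - + suc h) ℕ.+ #))
      ≡⟨ shuffle (F v) (F (v + + suc h)) (F (v - + suc h)) # ⟩
    F (v - + suc h) ℕ.+ ((F v ℕ.+ #) ℕ.+ F (v + + suc h))
      ≡⟨ cong (λ y → F (v - + suc h) ℕ.+ (y ℕ.+ F (v + + suc h))) (#neighbours-interval h f x v) ⟩
    F (v - + suc h) ℕ.+ (window 1ℤ (suc (h ℕ.+ h)) F (v - + h) ℕ.+ F (v + + suc h))
      ≡⟨ cong₂ (λ y z → F (v - + suc h) ℕ.+ (window 1ℤ (suc (h ℕ.+ h)) F y ℕ.+ F z)) (left v (+ h)) (right v (+ h)) ⟩
    F (v - + suc h) ℕ.+ (window 1ℤ (suc (h ℕ.+ h)) F (v - + suc h + 1ℤ) ℕ.+ F (v - + suc h + 1ℤ + + suc (h ℕ.+ h) * 1ℤ))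
      ≡⟨ cong (F (v - + suc h) ℕ.+_) (window-∷ʳ 1ℤ (suc (h ℕ.+ h)) F (v - + suc h + 1ℤ)) ⟨
    window 1ℤ (suc (suc (suc (h ℕ.+ h)))) F (v - + suc h)
      ≡⟨ cong (λ n → window 1ℤ (suc (suc n)) F (v - + suc h)) (ℕₚ.+-suc h h) ⟨
    window 1ℤ (suc (suc h ℕ.+ suc h)) F (v - + suc h) ∎
    where
    F = occurs f x
    # = #neighbours (C∞ (interval h)) f x v
    left : ∀ v h → v - h ≡ v - (1ℤ + h) + 1ℤ
    left = solve-∀
    right : ∀ v h → v + (1ℤ + h) ≡ v - (1ℤ + h) + 1ℤ + (1ℤ + (h + h)) * 1ℤ
    right = solve-∀
    open import Data.Nat.Tactic.RingSolver using () renaming (solve-∀ to solveℕ-∀)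
    shuffle : ∀ a b c d → a ℕ.+ (b ℕ.+ (c ℕ.+ d)) ≡ c ℕ.+ ((a ℕ.+ d) ℕ.+ b)
    shuffle = solveℕ-∀

  odds : ∀ h → Vec ℕ h
  odds zero    = []
  odds (suc h) = suc (h ℕ.+ h) ∷ odds h

  -- The odd displacements from `1 - 2h` to `2h - 1` form a progression of step 2 that skips `v`
  -- without leaving a gap.
  #neighbours-odds : ∀ h f x v → #neighbours (C∞ (odds h)) f x v
                                 ≡ window (+ 2) (h ℕ.+ h) (occurs f x) (v + 1ℤ - + (h ℕ.+ h))
  #neighbours-odds zero    f x v = refl
  #neighbours-odds (suc h) f x v = begin
    #neighbours (C∞ (odds (suc h))) f x v
      ≡⟨ #neighbours-∷ l (odds h) f x v ⟩
    F (v + + l) ℕ.+ (F (v - + l) ℕ.+ #neighbours (C∞ (odds h)) f x v)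
      ≡⟨ shuffle (F (v + + l)) (F (v - + l)) _ ⟩
    F (v - + l) ℕ.+ (#neighbours (C∞ (odds h)) f x v ℕ.+ F (v + + l))
      ≡⟨ cong (λ y → F (v - + l) ℕ.+ (y ℕ.+ F (v + + l))) (#neighbours-odds h f x v) ⟩
    F (v - + l) ℕ.+ (window (+ 2) (h ℕ.+ h) F (v + 1ℤ - + (h ℕ.+ h)) ℕ.+ F (v + + l))
      ≡⟨ cong₂ (λ y z → F (v - + l) ℕ.+ (window (+ 2) (h ℕ.+ h) F y ℕ.+ F z)) (left v (+ h)) (right v (+ h)) ⟩
    F (v - + l) ℕ.+ (window (+ 2) (h ℕ.+ h) F (v - + l + + 2) ℕ.+ F (v - + l + + 2 + + (h ℕ.+ h) * + 2))
      ≡⟨ cong (F (v - + l) ℕ.+_) (window-∷ʳ (+ 2) (h ℕ.+ h) F (v - + l + + 2)) ⟨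
    window (+ 2) (suc (suc (h ℕ.+ h))) F (v - + l)
      ≡⟨ cong₂ (λ n y → window (+ 2) n F y) (cong suc (sym (ℕₚ.+-suc h h))) (start v (+ h)) ⟩
    window (+ 2) (suc h ℕ.+ suc h) F (v + 1ℤ - + (suc h ℕ.+ suc h)) ∎
    where
    F = occurs f x
    l = suc (h ℕ.+ h)
    left : ∀ v h → v + 1ℤ - (h + h) ≡ v - (1ℤ + (h + h)) + + 2
    left = solve-∀
    right : ∀ v h → v + (1ℤ + (h + h)) ≡ v - (1ℤ + (h + h)) + + 2 + (h + h) * + 2
    right = solve-∀
    start : ∀ v h → v - (1ℤ + (h + h)) ≡ v + 1ℤ - ((1ℤ + h) + (1ℤ + h))
    start = solve-∀
    open import Data.Nat.Tactic.RingSolver using () renaming (solve-∀ to solveℕ-∀)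
    shuffle : ∀ a b c → a ℕ.+ (b ℕ.+ c) ≡ b ℕ.+ (c ℕ.+ a)
    shuffle = solveℕ-∀

  [a+n]%ℕn≡a%ℕn : ∀ a n .{{_ : ℕ.NonZero n}} → (a + + n) %ℕ n ≡ a %ℕ n
  [a+n]%ℕn≡a%ℕn a n = ℤₚ.+-injective (ℤₚ.i-j≡0⇒i≡j (+ r′) (+ r) (∣∧small⇒≡0 {n}
    (divides (1ℤ + a /ℕ n - (a + + n) /ℕ n) difference) small))
    where
    r  = a %ℕ n
    r′ = (a + + n) %ℕ n
    isolate : ∀ r q n → r ≡ r + q * n - q * n
    isolate = solve-∀
    collect : ∀ r q q′ n → r + q * n + n - q′ * n - r ≡ (1ℤ + q - q′) * n
    collect = solve-∀
    difference : + r′ - + r ≡ (1ℤ + a /ℕ n - (a + + n) /ℕ n) * + n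
    difference = begin
      + r′ - + r                                                  ≡⟨ cong (_- + r) (isolate (+ r′) ((a + + n) /ℕ n) (+ n)) ⟩
      + r′ + (a + + n) /ℕ n * + n - (a + + n) /ℕ n * + n - + r    ≡⟨ cong (λ y → y - (a + + n) /ℕ n * + n - + r) (a≡a%ℕn+[a/ℕn]*n (a + + n) n) ⟨
      a + + n - (a + + n) /ℕ n * + n - + r                        ≡⟨ cong (λ y → y + + n - (a + + n) /ℕ n * + n - + r) (a≡a%ℕn+[a/ℕn]*n a n) ⟩
      + r + a /ℕ n * + n + + n - (a + + n) /ℕ n * + n - + r       ≡⟨ collect (+ r) (a /ℕ n) ((a + + n) /ℕ n) (+ n) ⟩
      (1ℤ + a /ℕ n - (a + + n) /ℕ n) * + n                        ∎
    small : ∣ + r′ - + r ∣ ℕ.< n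
    small = ℕₚ.≤-<-trans (subst (λ y → ∣ y ∣ ℕ.≤ r′ ℕ.⊔ r) (sym (ℤₚ.m-n≡m⊖n r′ r)) (ℤₚ.∣m⊝n∣≤m⊔n r′ r))
      (ℕₚ.⊔-lub (n%ℕd<d (a + + n) n) (n%ℕd<d a n))

  module _ (b c : ℕ) .{{_ : ℕ.NonZero (c ℕ.+ b)}} where

    weight : Colour → ℕ
    weight black = c
    weight white = b

    residueColour : ℕ → Colour
    residueColour r = if does (r ℕ.<? c) then black else white

    residueColour-< : ∀ {r} → r ℕ.< c → residueColour r ≡ black
    residueColour-< {r} r<c = cong (λ t → if t then black else white) (dec-true (r ℕ.<? c) r<c)

    residueColour-≥ : ∀ {r} → c ℕ.≤ r → residueColour r ≡ white
    residueColour-≥ {r} c≤r = cong (λ t → if t then black else white) (dec-false (r ℕ.<? c) (ℕₚ.≤⇒≯ c≤r))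

    periodicColouring : ℤ → Colour
    periodicColouring v = residueColour (v %ℕ (c ℕ.+ b))

    private
      n = c ℕ.+ b
      f = periodicColouring

    occurs-periodic : ∀ x v → occurs f x (v + + n) ≡ occurs f x v
    occurs-periodic x v = cong (λ r → if does (residueColour r ≟ᶜ x) then 1 else 0) ([a+n]%ℕn≡a%ℕn v n)

    -- By periodicity the window may start at 0, where the `c` black residues come first.
    window-period : ∀ x v → window 1ℤ n (occurs f x) v ≡ weight x
    window-period x v = begin
      window 1ℤ n F v                                                 ≡⟨ window-translate {n} (occurs-periodic x) v ⟩
      window 1ℤ (c ℕ.+ b) F 0ℤ                                        ≡⟨ window-+ 1ℤ c b F 0ℤ ⟩
      window 1ℤ c F 0ℤ ℕ.+ window 1ℤ b F (0ℤ + + c * 1ℤ)              ≡⟨ cong (λ y → window 1ℤ c F 0ℤ ℕ.+ window 1ℤ b F y) (trans (ℤₚ.+-identityˡ _) (ℤₚ.*-identityʳ (+ c))) ⟩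
      window 1ℤ c F 0ℤ ℕ.+ window 1ℤ b F (+ c)                        ≡⟨ cong₂ ℕ._+_ (window-const c (δ black) first) (window-const b (δ white) second) ⟩
      c ℕ.* δ black ℕ.+ b ℕ.* δ white                                 ≡⟨ total x ⟩
      weight x                                                        ∎
      where
      F = occurs f x
      δ : Colour → ℕ
      δ y = if does (y ≟ᶜ x) then 1 else 0
      first : ∀ {i} → i ℕ.< c → F (+ i) ≡ δ black
      first {i} i<c = cong δ (trans (cong residueColour (ℕ/.m<n⇒m%n≡m (ℕₚ.<-≤-trans i<c (ℕₚ.m≤m+n c b)))) (residueColour-< i<c))
      second : ∀ {i} → i ℕ.< b → F (+ (c ℕ.+ i)) ≡ δ white
      second {i} i<b = cong δ (trans (cong residueColour (ℕ/.m<n⇒m%n≡m (ℕₚ.+-monoʳ-< c i<b))) (residueColour-≥ (ℕₚ.m≤m+n c i)))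
      total : ∀ x → c ℕ.* (if does (black ≟ᶜ x) then 1 else 0) ℕ.+ b ℕ.* (if does (white ≟ᶜ x) then 1 else 0) ≡ weight x
      total black = trans (cong₂ ℕ._+_ (ℕₚ.*-identityʳ c) (ℕₚ.*-zeroʳ b)) (ℕₚ.+-identityʳ c)
      total white = cong₂ ℕ._+_ (ℕₚ.*-zeroʳ c) (ℕₚ.*-identityʳ b)

    #neighbours-interval-≢ : ∀ h x v → f v ≢ x → #neighbours (C∞ (interval h)) f x v
                             ≡ window 1ℤ (suc (h ℕ.+ h)) (occurs f x) (v - + h)
    #neighbours-interval-≢ h x v fv≢x = trans
      (cong (ℕ._+ #neighbours (C∞ (interval h)) f x v) (sym (occurs-≢ f x {v} fv≢x)))
      (#neighbours-interval h f x v)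

    -- The integers from `v - h` to `v + h` are one full period, and `v` itself does not have the
    -- colour counted.
    perfect-odd : ∀ h → n ≡ suc (h ℕ.+ h) → Perfect f h weight
    perfect-odd h n≡1+2h = interval h , λ x v fv≢x → begin
      #neighbours (C∞ (interval h)) f x v                    ≡⟨ #neighbours-interval-≢ h x v fv≢x ⟩
      window 1ℤ (suc (h ℕ.+ h)) (occurs f x) (v - + h)       ≡⟨ cong (λ m → window 1ℤ m (occurs f x) (v - + h)) n≡1+2h ⟨
      window 1ℤ n (occurs f x) (v - + h)                     ≡⟨ window-period x (v - + h) ⟩
      weight x                                               ∎

    -- The integers from `v - h` to `v + h` are one short of two periods. The missing point `v + n`
    -- has the colour of `v`, so it may be added without changing the count.
    perfect-double : ∀ h → n ≡ suc h → Perfect f h (λ x → weight x ℕ.+ weight x)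
    perfect-double h n≡1+h = interval h , λ x v fv≢x → let F = occurs f x in begin
      #neighbours (C∞ (interval h)) f x v                               ≡⟨ #neighbours-interval-≢ h x v fv≢x ⟩
      window 1ℤ (suc (h ℕ.+ h)) F (v - + h)                             ≡⟨ ℕₚ.+-identityʳ _ ⟨
      window 1ℤ (suc (h ℕ.+ h)) F (v - + h) ℕ.+ 0                       ≡⟨ cong (window 1ℤ (suc (h ℕ.+ h)) F (v - + h) ℕ.+_) (begin
        F (v - + h + + suc (h ℕ.+ h) * 1ℤ)                                  ≡⟨ cong F (last v (+ h)) ⟩
        F (v + + suc h)                                                     ≡⟨ cong (λ m → F (v + + m)) n≡1+h ⟨
        F (v + + n)                                                         ≡⟨ occurs-periodic x v ⟩
        F v                                                                 ≡⟨ occurs-≢ f x {v} fv≢x ⟩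
        0                                                                   ∎) ⟨
      window 1ℤ (suc (h ℕ.+ h)) F (v - + h) ℕ.+ F (v - + h + + suc (h ℕ.+ h) * 1ℤ)  ≡⟨ window-∷ʳ 1ℤ (suc (h ℕ.+ h)) F (v - + h) ⟨
      window 1ℤ (suc (suc (h ℕ.+ h))) F (v - + h)                       ≡⟨ cong (λ m → window 1ℤ m F (v - + h)) (trans (cong suc (sym (ℕₚ.+-suc h h))) (sym (cong₂ ℕ._+_ n≡1+h n≡1+h))) ⟩
      window 1ℤ (n ℕ.+ n) F (v - + h)                                   ≡⟨ window-+ 1ℤ n n F (v - + h) ⟩
      window 1ℤ n F (v - + h) ℕ.+ window 1ℤ n F (v - + h + + n * 1ℤ)    ≡⟨ cong₂ ℕ._+_ (window-period x _) (window-period x _) ⟩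
      weight x ℕ.+ weight x                                             ∎
      where
      last : ∀ v h → v - h + (1ℤ + (h + h)) * 1ℤ ≡ v + (1ℤ + h)
      last = solve-∀

    -- The floor of `v / 2`, also for negative `v`, so that a step of 2 is always a step of 1 after
    -- halving.
    half : ℤ → ℤ
    half (+ m)    = + ℕ.⌊ m /2⌋
    half -[1+ m ] = -[1+ ℕ.⌊ m /2⌋ ]

    half-+2 : ∀ v → half (v + + 2) ≡ half v + 1ℤ
    half-+2 (+ m) = trans (cong half (ℤₚ.+-comm (+ m) (+ 2))) (ℤₚ.+-comm 1ℤ (+ ℕ.⌊ m /2⌋))
    half-+2 -[1+ zero ]        = refl
    half-+2 -[1+ suc zero ]    = refl
    half-+2 -[1+ suc (suc m) ] = refl

    window-half : ∀ m F v → window (+ 2) m (F ∘ half) v ≡ window 1ℤ m F (half v)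
    window-half zero    F v = refl
    window-half (suc m) F v = cong (F (half v) ℕ.+_)
      (trans (window-half m F (v + + 2)) (cong (window 1ℤ m F) (half-+2 v)))

    -- After halving, the `2h` neighbours become `n` consecutive integers, one full period, whatever
    -- the colour of `v`.
    perfect-even : ∀ h → n ≡ h ℕ.+ h → Perfect (f ∘ half) h weight
    perfect-even h n≡2h = odds h , λ x v _ → let u = v + 1ℤ - + (h ℕ.+ h) in begin
      #neighbours (C∞ (odds h)) (f ∘ half) x v                    ≡⟨ #neighbours-odds h (f ∘ half) x v ⟩
      window (+ 2) (h ℕ.+ h) (occurs f x ∘ half) u                ≡⟨ window-half (h ℕ.+ h) (occurs f x) u ⟩
      window 1ℤ (h ℕ.+ h) (occurs f x) (half u)                   ≡⟨ cong (λ m → window 1ℤ m (occurs f x) (half u)) n≡2h ⟨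
      window 1ℤ n (occurs f x) (half u)                           ≡⟨ window-period x (half u) ⟩
      weight x                                                    ∎

  parity : ∀ n → ∃[ h ] (n ≡ h ℕ.+ h ⊎ n ≡ suc (h ℕ.+ h))
  parity zero = 0 , inj₁ refl
  parity (suc n) with parity n
  ... | h , inj₁ refl = h , inj₂ refl
  ... | h , inj₂ refl = suc h , inj₁ (cong suc (sym (ℕₚ.+-suc h h)))

  prime∣prime^⇒≡ : ∀ {p q} s → Prime p → Prime q → p ℕ∣.∣ q ℕ.^ s → p ≡ q
  prime∣prime^⇒≡ {p} zero p-prime q-prime p∣1 =
    contradiction (ℕ∣.∣⇒≤ p∣1) (ℕₚ.<⇒≱ (ℕ.nonTrivial⇒n>1 p {{prime⇒nonTrivial p-prime}}))
  prime∣prime^⇒≡ {p} {q} (suc s) p-prime q-prime p∣q^1+s with euclidsLemma q (q ℕ.^ s) p-prime p∣q^1+s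
  ... | inj₂ p∣q^s = prime∣prime^⇒≡ s p-prime q-prime p∣q^s
  ... | inj₁ p∣q with prime⇒irreducible q-prime p∣q
  ...   | inj₁ refl = contradiction (ℕ.nonTrivial⇒n>1 1 {{prime⇒nonTrivial p-prime}}) (ℕₚ.<-irrefl refl)
  ...   | inj₂ p≡q  = p≡q

  isPerfectColouring : ∀ {f k C} (p : Perfect f k C) → IsPerfectColouring (C∞ (proj₁ p)) (C white) (C black) f
  isPerfectColouring (ls , p) = record
    { black-vertex = λ v fv≡black → p white v (λ fv≡white → contradiction (trans (sym fv≡black) fv≡white) λ ())
    ; white-vertex = λ v fv≡white → p black v (λ fv≡black → contradiction (trans (sym fv≡white) fv≡black) λ ())
    }

  private
    -- The slack of 1 is absorbed by parity. It is needed when the gcd is 1, where the bound reads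
    -- `h + h ≤ 2k + 1`.
    halve-≤ : ∀ {m n} → m ℕ.+ m ℕ.≤ suc (n ℕ.+ n) → m ℕ.≤ n
    halve-≤ {zero}          _ = ℕ.z≤n
    halve-≤ {suc m} {zero}  (ℕ.s≤s m+1+m≤0) = contradiction (subst (ℕ._≤ 0) (ℕₚ.+-suc m m) m+1+m≤0) λ ()
    halve-≤ {suc m} {suc n} (ℕ.s≤s le) = ℕ.s≤s (halve-≤ (ℕ.s≤s⁻¹
      (subst₂ ℕ._≤_ (ℕₚ.+-suc m m) (cong suc (ℕₚ.+-suc n n)) le)))

  sufficiency : ∀ {k b c q} s → 0 ℕ.< c → Prime q → b ℕ.+ c ≡ q ℕ.^ s →
                b ℕ.+ c ℕ.≤ 2 ℕ.* k ℕ.+ gcd b c →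
                Σ[ ls ∈ Vec ℕ k ] ∃[ f ] IsPerfectColouring (C∞ ls) b c f
  sufficiency {k} {b} {c} {q} s 0<c q-prime b+c≡q^s b+c≤ = cases (parity d) (parity m)
    where
    open import Data.Nat.Tactic.RingSolver using () renaming (solve-∀ to solveℕ-∀)
    d = gcd b c
    b′ = ℕ∣._∣_.quotient (gcd[m,n]∣m b c)
    c′ = ℕ∣._∣_.quotient (gcd[m,n]∣n b c)
    b≡b′d : b ≡ b′ ℕ.* d
    b≡b′d = ℕ∣._∣_.equality (gcd[m,n]∣m b c)
    c≡c′d : c ≡ c′ ℕ.* d
    c≡c′d = ℕ∣._∣_.equality (gcd[m,n]∣n b c)
    instance
      c′≢0 : ℕ.NonZero c′
      c′≢0 = ℕ.≢-nonZero (λ c′≡0 → ℕₚ.<⇒≢ 0<c (sym (trans c≡c′d (cong (ℕ._* d) c′≡0))))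
      d≢0 : ℕ.NonZero d
      d≢0 = ℕ.≢-nonZero (λ d≡0 → ℕₚ.<⇒≢ 0<c (sym (trans c≡c′d (trans (cong (c′ ℕ.*_) d≡0) (ℕₚ.*-zeroʳ c′)))))
      c′+b′≢0 : ℕ.NonZero (c′ ℕ.+ b′)
      c′+b′≢0 = ℕ.>-nonZero (ℕₚ.<-≤-trans (ℕ.>-nonZero⁻¹ c′) (ℕₚ.m≤m+n c′ b′))
      c+b≢0 : ℕ.NonZero (c ℕ.+ b)
      c+b≢0 = ℕ.>-nonZero (ℕₚ.<-≤-trans 0<c (ℕₚ.m≤m+n c b))
    m = c′ ℕ.+ b′
    b+c≡m*d : b ℕ.+ c ≡ m ℕ.* d
    b+c≡m*d = begin
      b ℕ.+ c                   ≡⟨ cong₂ ℕ._+_ b≡b′d c≡c′d ⟩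
      b′ ℕ.* d ℕ.+ c′ ℕ.* d     ≡⟨ ℕₚ.*-distribʳ-+ d b′ c′ ⟨
      (b′ ℕ.+ c′) ℕ.* d         ≡⟨ cong (ℕ._* d) (ℕₚ.+-comm b′ c′) ⟩
      m ℕ.* d                   ∎
    result : ∀ {f C} → Perfect f k C → C white ≡ b → C black ≡ c →
             Σ[ ls ∈ Vec ℕ k ] ∃[ f ] IsPerfectColouring (C∞ ls) b c f
    result {f} p refl refl = proj₁ p , f , isPerfectColouring p
    -- Covering the `m - 1` nonzero residues `d` times each takes `(m - 1) * d` neighbours, and the
    -- assumed inequality says precisely that `2k` are enough.
    [m-1]*d≤2k : ∀ h → m ≡ suc h → h ℕ.* d ℕ.≤ k ℕ.+ k
    [m-1]*d≤2k h m≡1+h = ℕₚ.+-cancelˡ-≤ d _ _ (subst₂ ℕ._≤_ (trans b+c≡m*d (cong (ℕ._* d) m≡1+h))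
      (trans (ℕₚ.+-comm (2 ℕ.* k) d) (cong (λ a → d ℕ.+ (k ℕ.+ a)) (ℕₚ.+-identityʳ k))) b+c≤)
    assemble : ∀ a e → (e ℕ.+ e) ℕ.* a ≡ e ℕ.* (a ℕ.+ a)
    assemble = solveℕ-∀
    doubled : ∀ a e → a ℕ.* (e ℕ.+ e) ≡ e ℕ.* a ℕ.+ e ℕ.* a
    doubled = solveℕ-∀
    doubledˡ : ∀ h d → (h ℕ.+ h) ℕ.* d ≡ d ℕ.* h ℕ.+ d ℕ.* h
    doubledˡ = solveℕ-∀
    weighted : ∀ x → d ℕ.* weight b′ c′ x ≡ weight b c x
    weighted black = trans (ℕₚ.*-comm d c′) (sym c≡c′d)
    weighted white = trans (ℕₚ.*-comm d b′) (sym b≡b′d)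

    -- One copy of the distances `1` to `m - 1` covers each nonzero residue twice, so half of `d`
    -- copies are taken.
    even-gcd : ∀ e → d ≡ e ℕ.+ e → Σ[ ls ∈ Vec ℕ k ] ∃[ f ] IsPerfectColouring (C∞ ls) b c f
    even-gcd e d≡2e = result (perfect-pad e*h≤k (perfect-* e (perfect-double b′ c′ h m≡1+h)))
      (total white) (total black)
      where
      h = ℕ.pred m
      m≡1+h = sym (ℕₚ.suc-pred m)
      e*h≤k : e ℕ.* h ℕ.≤ k
      e*h≤k = halve-≤ (ℕₚ.m≤n⇒m≤1+n (subst (ℕ._≤ k ℕ.+ k) (trans (cong (h ℕ.*_) d≡2e) (doubled h e)) ([m-1]*d≤2k h m≡1+h)))
      total : ∀ x → e ℕ.* (weight b′ c′ x ℕ.+ weight b′ c′ x) ≡ weight b c x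
      total x = trans (sym (assemble (weight b′ c′ x) e)) (trans (cong (ℕ._* weight b′ c′ x) (sym d≡2e)) (weighted x))

    odd-quotient : ∀ h → m ≡ suc (h ℕ.+ h) → Σ[ ls ∈ Vec ℕ k ] ∃[ f ] IsPerfectColouring (C∞ ls) b c f
    odd-quotient h m≡1+2h = result (perfect-pad d*h≤k (perfect-* d (perfect-odd b′ c′ h m≡1+2h)))
      (weighted white) (weighted black)
      where
      d*h≤k : d ℕ.* h ℕ.≤ k
      d*h≤k = halve-≤ (ℕₚ.m≤n⇒m≤1+n (subst (ℕ._≤ k ℕ.+ k) (doubledˡ h d) ([m-1]*d≤2k (h ℕ.+ h) m≡1+2h)))

    -- Then q = 2, so d is a power of 2 and hence equal to 1.
    odd-gcd-even-quotient : ∀ e h → d ≡ suc (e ℕ.+ e) → m ≡ h ℕ.+ h →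
                            Σ[ ls ∈ Vec ℕ k ] ∃[ f ] IsPerfectColouring (C∞ ls) b c f
    odd-gcd-even-quotient e h d≡1+2e m≡2h =
      result (perfect-pad h≤k (perfect-even b c h c+b≡2h)) refl refl
      where
      double : ∀ h → h ℕ.+ h ≡ h ℕ.* 2
      double = solveℕ-∀
      2∣m : 2 ℕ∣.∣ m
      2∣m = ℕ∣.divides h (trans m≡2h (double h))
      m*d≡q^s : m ℕ.* d ≡ q ℕ.^ s
      m*d≡q^s = trans (sym b+c≡m*d) b+c≡q^s
      2≡q : 2 ≡ q
      2≡q = prime∣prime^⇒≡ s prime[2] q-prime (subst (2 ℕ∣.∣_) m*d≡q^s (ℕ∣.∣m⇒∣m*n d 2∣m))
      2∤d : ¬ 2 ℕ∣.∣ d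
      2∤d 2∣d = contradiction (ℕ∣.∣⇒≤ {{_}} (ℕ∣.∣m+n∣m⇒∣n {2} {e ℕ.+ e} {1}
        (subst (2 ℕ∣.∣_) (trans d≡1+2e (ℕₚ.+-comm 1 (e ℕ.+ e))) 2∣d) (ℕ∣.divides e (double e)))) λ { (ℕ.s≤s ()) }
      -- The product is `q ^ s`, and `q` does not divide `d`, so the whole power is already
      -- contained in `m`.
      m*d∣m : m ℕ.* d ℕ∣.∣ m
      m*d∣m = subst (ℕ∣._∣ m) (sym m*d≡q^s) (Binomial.q^j∣m*n⇒q^j∣n q-prime s (subst (λ p → ¬ p ℕ∣.∣ d) 2≡q 2∤d)
        (ℕ∣.∣-reflexive (trans (sym m*d≡q^s) (ℕₚ.*-comm m d))))
      d≡1 : d ≡ 1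
      d≡1 = ℕₚ.≤-antisym (ℕₚ.*-cancelˡ-≤ m (subst (m ℕ.* d ℕ.≤_) (sym (ℕₚ.*-identityʳ m)) (ℕ∣.∣⇒≤ m*d∣m)))
                         (ℕ.>-nonZero⁻¹ d)
      b+c≡2h : b ℕ.+ c ≡ h ℕ.+ h
      b+c≡2h = trans b+c≡m*d (trans (cong (m ℕ.*_) d≡1) (trans (ℕₚ.*-identityʳ m) m≡2h))
      c+b≡2h : c ℕ.+ b ≡ h ℕ.+ h
      c+b≡2h = trans (ℕₚ.+-comm c b) b+c≡2h
      h≤k : h ℕ.≤ k
      h≤k = halve-≤ (subst₂ ℕ._≤_ b+c≡2h
        (trans (cong (2 ℕ.* k ℕ.+_) d≡1) (trans (ℕₚ.+-comm (2 ℕ.* k) 1) (cong (λ a → suc (k ℕ.+ a)) (ℕₚ.+-identityʳ k)))) b+c≤)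

    cases : ∃[ e ] (d ≡ e ℕ.+ e ⊎ d ≡ suc (e ℕ.+ e)) → ∃[ h ] (m ≡ h ℕ.+ h ⊎ m ≡ suc (h ℕ.+ h)) →
            Σ[ ls ∈ Vec ℕ k ] ∃[ f ] IsPerfectColouring (C∞ ls) b c f
    cases (e , inj₁ d≡2e)   _                   = even-gcd e d≡2e
    cases (_ , inj₂ _)      (h , inj₂ m≡1+2h)   = odd-quotient h m≡1+2h
    cases (e , inj₂ d≡1+2e) (h , inj₁ m≡2h)     = odd-gcd-even-quotient e h d≡1+2e m≡2h

open import Data.Nat using (ℕ; _+_; _*_; _^_; _≤_; _≥_; _>_)
open import Data.Nat.GCD using (gcd)
open import Function.Bundles using (_⇔_; mk⇔)

theorem3 : ∀ (k b c : ℕ) → k ≥ 1 → b > 0 → c > 0 →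
    ∀ (q s : ℕ) → Prime q → s > 0 → b + c ≡ q ^ s →
    (Σ[ ls ∈ Vec ℕ k ] ∃[ f ] IsPerfectColouring (C∞ ls) b c f)
    ⇔ (b + c ≤ 2 * k + gcd b c)
theorem3 k b c _ 0<b 0<c q s q-prime _ b+c≡q^s = mk⇔
  (λ (ls , _ , perfect) → Necessity.necessity s 0<b 0<c q-prime b+c≡q^s ls perfect)
  (Construction.sufficiency s 0<c q-prime b+c≡q^s)
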